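{- For any fixed integers $r\geqslant 2$ and $1\leqslant s_1\leqslant\cdots\leqslant s_r$, $$\mathrm{sat}(n, K_{s_1, \ldots, s_r})=\left(s_1+\cdots+s_{r-1}+\frac{s_r-3}{2}\right)n+O(1),$$ where the implied constant depends only on $s_1,\ldots,s_r$.
   Context: All graphs are finite, undirected, without loops or multiple edges. $K_{s_1,\ldots,s_r}$ denotes the complete $r$-partite graph with parts of sizes $s_1,\ldots,s_r$. For a graph $F$, a graph $G$ is $F$-free if it has no subgraph isomorphic to $F$, and $G$ is $F$-saturated if $G$ is $F$-free and adding any edge joining two nonadjacent vertices of $G$ creates a subgraph isomorphic to $F$. $\mathrm{sat}(n,F)$ is the minimum number of edges of an $F$-saturated graph on $n$ vertices. -}

module Defs where

open import Data.Nat using (ℕ; zero; suc; _+_; _*_; _∸_; _≤_; _<ᵇ_)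
open import Data.Bool using (Bool; true; false; _∧_; _∨_; if_then_else_)
open import Data.Fin using (Fin; toℕ; _≟_; inject₁; fromℕ)
open import Data.List using (List; map; allFin)
open import Data.Nat.ListAction using (sum)
open import Data.Product using (Σ; ∃; _×_; _,_)
open import Relation.Binary.PropositionalEquality using (_≡_; _≢_)
open import Relation.Nullary using (¬_)
open import Relation.Nullary.Decidable using (⌊_⌋)
open import Function.Definitions using (Injective)

record Graph (n : ℕ) : Set where
  field
    adj   : Fin n → Fin n → Bool
    sym   : ∀ i j → adj i j ≡ adj j i
    irrefl : ∀ i → adj i i ≡ false
open Graph public

edgeCount : ∀ {n} → Graph n → ℕ
edgeCount {n} G =
  sum (map (λ i → sum (map (λ j →
         if (toℕ i <ᵇ toℕ j) ∧ adj G i j then 1 else 0) (allFin n))) (allFin n))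

Contains : ∀ {n} (V : Set) (E : V → V → Set) → (Fin n → Fin n → Bool) → Set
Contains {n} V E A =
  Σ (V → Fin n) λ φ → Injective _≡_ _≡_ φ × (∀ x y → E x y → A (φ x) (φ y) ≡ true)

addEdge : ∀ {n} → (Fin n → Fin n → Bool) → Fin n → Fin n → (Fin n → Fin n → Bool)
addEdge A u v x y =
  A x y ∨ (⌊ x ≟ u ⌋ ∧ ⌊ y ≟ v ⌋) ∨ (⌊ x ≟ v ⌋ ∧ ⌊ y ≟ u ⌋)

Saturated : ∀ {n} (V : Set) (E : V → V → Set) → Graph n → Set
Saturated V E G =
  ¬ Contains V E (adj G) ×
  (∀ u v → u ≢ v → adj G u v ≡ false → Contains V E (addEdge (adj G) u v))

KVert : ∀ {r} → (Fin r → ℕ) → Set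
KVert {r} s = Σ (Fin r) (λ i → Fin (s i))

KEdge : ∀ {r} (s : Fin r → ℕ) → KVert s → KVert s → Set
KEdge s (i , _) (j , _) = i ≢ j

-- For r = suc m parts: twice the coefficient, 2(s_1+...+s_{r-1}) + s_r - 3.
twiceCoeff : ∀ m → (Fin (suc m) → ℕ) → ℕ
twiceCoeff m s = 2 * sum (map (λ i → s (inject₁ i)) (allFin m)) + s (fromℕ m) ∸ 3

{-# OPTIONS --safe #-}
-- Write F = K_{s_1,…,s_r}, p = s_1 + … + s_{r-1}, s = s_r and c = 2p + s − 3.
--
-- Upper bound: join K_{p-1} to disjoint copies of K_s (and one smaller clique). Deleting the p − 1 dominating
-- vertices from a copy of F leaves a connected graph on more than s vertices, so there is no copy; and an edge
-- between two blocks, one of them a K_s, creates the star K_{1,s}, which p − 1 dominating vertices extend to F.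
--
-- Lower bound: fix a degree threshold and call a vertex low below it, high otherwise. The weight of u is
-- 2 d_H(u) + d_L(u), where d_H and d_L count high and low neighbours; it is the number of edge ends charged to u
-- if each low–high edge is charged to its low end. Take two low vertices u, v of weight at most c, with
-- d_H(u) = d_H(v), far apart in the graph of low vertices, and number the high neighbours of each.
-- In a copy of F in G + uv the part of one of them, say of u, has no other low vertex, and unless for some t the
-- t-th high neighbours of u and of v are adjacent, the numbering turns the copy into an injection that forces
-- weight(u) ≥ c, and weight(u) > c if v has a high neighbour at no short distance from u. By Ramsey's theorem,
-- too many exceptions would thus give a sequence u_1, u_2, … whose t-th high neighbours form a large clique,
-- hence a copy of F. So all but boundedly many low vertices have weight at least c, and all but boundedly
-- many high vertices have only low neighbours of weight greater than c, from each of which they can take a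
-- fraction of the surplus; having high degree, they end up with a charge of at least c too.
module Submission where

open import Defs
open import Data.Nat using (ℕ; zero; suc; _+_; _*_; _∸_; _^_; _≤_; _<_; _<?_; _≤?_; _<ᵇ_; _/_; _%_; z≤n; s≤s)
open import Data.Nat.Properties
open import Data.Nat.DivMod using (m≡m%n+[m/n]*n; m%n<n; +-distrib-/-∣ʳ; m*n/n≡m; m<n⇒m/n≡0)
open import Data.Nat.Divisibility using (n∣m*n)
open import Data.Nat.ListAction using (sum)
open import Data.Nat.ListAction.Properties using (sum-++)
open import Data.Nat.Tactic.RingSolver using (solve-∀)
open import Data.Bool using (Bool; true; false; T; _∧_; _∨_; if_then_else_)
import Data.Bool as Bool
open import Data.Bool.Properties using (¬-not; ∨-zeroʳ)
open import Data.Fin using (Fin; toℕ; inject₁; fromℕ)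
import Data.Fin as F
import Data.Fin.Properties as Fin
open import Data.Fin.Relation.Unary.Top using (View; view; ‵fromℕ; ‵inj₁)
open import Data.List using (List; []; _∷_; _++_; [_]; map; length; filter; concatMap; allFin; upTo)
open import Data.List.Properties using (length-++; length-map; length-tabulate; length-upTo; map-++; map-∘)
open import Data.List.Membership.Propositional using (_∈_; find; lose)
open import Data.List.Membership.Propositional.Properties
import Data.List.Membership.DecPropositional as DecMembership
open import Data.List.Relation.Unary.All as All using (All; []; _∷_)
open import Data.List.Relation.Unary.Any as Any using (here; there)
open import Data.List.Relation.Unary.AllPairs as AllPairs using (AllPairs; []; _∷_)
import Data.List.Relation.Unary.AllPairs.Properties as AllPairs
open import Data.List.Relation.Unary.Unique.Propositional using (Unique)
import Data.List.Relation.Unary.Unique.Propositional.Properties as Unique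
open import Data.Product using (Σ; ∃; _×_; _,_; proj₁; proj₂)
open import Data.Product.Properties using (≡-dec)
open import Data.Sum using (_⊎_; inj₁; inj₂)
open import Data.Empty using (⊥; ⊥-elim)
open import Function using (_∘_; id)
open import Function.Definitions using (Injective)
open import Relation.Binary using (tri<; tri≈; tri>)
open import Relation.Binary.PropositionalEquality using (_≡_; _≢_; refl; trans; cong; cong₂; subst; module ≡-Reasoning) renaming (sym to ≡-sym)
open import Relation.Nullary using (¬_; Dec; yes; no)
open import Relation.Nullary.Decidable using (_×-dec_; _⊎-dec_; ¬?; ⌊_⌋)
open import Relation.Unary using (Decidable)

-- Counting in lists and finite sums.

-- A relation instead of a function, so that each application may choose the partner of `x` by
-- cases. The partner of the head is removed from `ys`; by injectivity the partners of the tail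
-- survive.
length-≤ : {A B : Set} (R : A → B → Set) → (∀ {a b y} → R a y → R b y → a ≡ b) →
  ∀ {xs ys} → Unique xs → (∀ {x} → x ∈ xs → ∃ λ y → y ∈ ys × R x y) → length xs ≤ length ys
length-≤ R inj [] f = z≤n
length-≤ R inj {x ∷ xs} (x∉ ∷ u) f with f (here refl)
... | y , y∈ , Rxy with ∈-∃++ y∈
... | ys , zs , refl = begin
    suc (length xs)              ≤⟨ s≤s (length-≤ R inj u g) ⟩
    suc (length (ys ++ zs))      ≡⟨ cong suc (length-++ ys) ⟩
    suc (length ys + length zs)  ≡⟨ +-suc (length ys) _ ⟨
    length ys + suc (length zs)  ≡⟨ length-++ ys ⟨
    length (ys ++ y ∷ zs)        ∎
  where
  open ≤-Reasoning
  g : ∀ {a} → a ∈ xs → ∃ λ b → b ∈ ys ++ zs × R a b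
  g a∈ with f (there a∈)
  ... | b , b∈ , Rab with ∈-++⁻ ys b∈
  ... | inj₁ b∈ys = b , ∈-++⁺ˡ b∈ys , Rab
  ... | inj₂ (here refl) = ⊥-elim (All.lookup x∉ a∈ (inj Rxy Rab))
  ... | inj₂ (there b∈zs) = b , ∈-++⁺ʳ ys b∈zs , Rab

length-⊆ : {A : Set} {xs ys : List A} → Unique xs → (∀ {x} → x ∈ xs → x ∈ ys) → length xs ≤ length ys
length-⊆ u f = length-≤ _≡_ (λ p q → trans p (≡-sym q)) u (λ x∈ → _ , f x∈ , refl)

∑ : {A : Set} → List A → (A → ℕ) → ℕ
∑ xs f = sum (map f xs)

∑-cong : {A : Set} (xs : List A) {f g : A → ℕ} → (∀ x → f x ≡ g x) → ∑ xs f ≡ ∑ xs g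
∑-cong [] h = refl
∑-cong (x ∷ xs) h = cong₂ _+_ (h x) (∑-cong xs h)

∑-mono : {A : Set} (xs : List A) {f g : A → ℕ} → (∀ {x} → x ∈ xs → f x ≤ g x) → ∑ xs f ≤ ∑ xs g
∑-mono [] h = z≤n
∑-mono (x ∷ xs) h = +-mono-≤ (h (here refl)) (∑-mono xs (h ∘ there))

∑-const : {A : Set} (xs : List A) (k : ℕ) → ∑ xs (λ _ → k) ≡ length xs * k
∑-const [] k = refl
∑-const (x ∷ xs) k = cong (k +_) (∑-const xs k)

interchange : ∀ a b c d → (a + b) + (c + d) ≡ (a + c) + (b + d)
interchange = solve-∀

∑-+ : {A : Set} (xs : List A) (f g : A → ℕ) → ∑ xs (λ x → f x + g x) ≡ ∑ xs f + ∑ xs g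
∑-+ [] f g = refl
∑-+ (x ∷ xs) f g = trans (cong (f x + g x +_) (∑-+ xs f g)) (interchange (f x) (g x) _ _)

∑-* : {A : Set} (xs : List A) (k : ℕ) (f : A → ℕ) → ∑ xs (λ x → k * f x) ≡ k * ∑ xs f
∑-* [] k f = ≡-sym (*-zeroʳ k)
∑-* (x ∷ xs) k f = trans (cong (k * f x +_) (∑-* xs k f)) (≡-sym (*-distribˡ-+ k (f x) _))

∑-swap : {A B : Set} (xs : List A) (ys : List B) (f : A → B → ℕ) →
  ∑ xs (λ x → ∑ ys (f x)) ≡ ∑ ys (λ y → ∑ xs (λ x → f x y))
∑-swap [] ys f = ≡-sym (trans (∑-const ys 0) (*-zeroʳ (length ys)))
∑-swap (x ∷ xs) ys f = trans (cong (∑ ys (f x) +_) (∑-swap xs ys f)) (≡-sym (∑-+ ys (f x) _))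

𝟙 : {P : Set} → Dec P → ℕ
𝟙 (yes _) = 1
𝟙 (no _) = 0

∑-𝟙 : {A : Set} {P : A → Set} (P? : Decidable P) (xs : List A) → ∑ xs (λ x → 𝟙 (P? x)) ≡ length (filter P? xs)
∑-𝟙 P? [] = refl
∑-𝟙 P? (x ∷ xs) with P? x
... | yes _ = cong suc (∑-𝟙 P? xs)
... | no _ = ∑-𝟙 P? xs

∑-split : {A : Set} (b : A → Bool) (xs : List A) (k l : ℕ) → ∑ xs (λ x → if b x then k else l)
  ≡ k * length (filter (λ x → b x Bool.≟ true) xs) + l * length (filter (λ x → b x Bool.≟ false) xs)
∑-split b [] k l = ≡-sym (cong₂ _+_ (*-zeroʳ k) (*-zeroʳ l))
∑-split b (x ∷ xs) k l with b x
... | true = trans (cong (k +_) (∑-split b xs k l)) (lem k l _ _)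
  where
  lem : ∀ k l a c → k + (k * a + l * c) ≡ k * suc a + l * c
  lem = solve-∀
... | false = trans (cong (l +_) (∑-split b xs k l)) (lem k l _ _)
  where
  lem : ∀ k l a c → l + (k * a + l * c) ≡ k * a + l * suc c
  lem = solve-∀

∑-filter : {A : Set} (b : A → Bool) (xs : List A) (f : A → ℕ) →
  ∑ xs (λ x → if b x then f x else 0) ≡ ∑ (filter (λ x → b x Bool.≟ true) xs) f
∑-filter b [] f = refl
∑-filter b (x ∷ xs) f with b x
... | true = cong (f x +_) (∑-filter b xs f)
... | false = ∑-filter b xs f

-- The default gives every vertex a `t`-th high neighbour for every `t`, so that pairs can be
-- coloured by a position without regard to degrees.
nth : {A : Set} → A → List A → ℕ → A
nth d [] _ = d
nth d (x ∷ xs) zero = x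
nth d (x ∷ xs) (suc t) = nth d xs t

∈-nth : {A : Set} (d : A) {x : A} {xs : List A} → x ∈ xs → ∃ λ t → t < length xs × nth d xs t ≡ x
∈-nth d (here refl) = 0 , s≤s z≤n , refl
∈-nth d (there x∈) with ∈-nth d x∈
... | t , t< , e = suc t , s≤s t< , e

nth-∈ : {A : Set} (d : A) (xs : List A) {t : ℕ} → t < length xs → nth d xs t ∈ xs
nth-∈ d (x ∷ xs) {zero} _ = here refl
nth-∈ d (x ∷ xs) {suc t} (s≤s t<) = there (nth-∈ d xs t<)

nth-injective : {A : Set} {x y : A} (xs : List A) {t : ℕ} → t < length xs → nth x xs t ≡ x → nth y xs t ≡ y → x ≡ y
nth-injective (z ∷ xs) {zero} _ e f = trans (≡-sym e) f
nth-injective (z ∷ xs) {suc t} (s≤s h) e f = nth-injective xs h e f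

AllPairs-nth : {A : Set} {R : A → A → Set} (d : A) {xs : List A} → AllPairs R xs →
  ∀ {i j} → i < j → j < length xs → R (nth d xs i) (nth d xs j)
AllPairs-nth d {x ∷ xs} (r ∷ rs) {zero} {suc j} _ (s≤s j<) = All.lookup r (nth-∈ d xs j<)
AllPairs-nth d (r ∷ rs) {suc i} {suc j} (s≤s i<j) (s≤s j<) = AllPairs-nth d rs i<j j<

-- One element is taken off, and the rest must exceed `K` classes of size `chainBound K k`: hence
-- the 2.
chainBound : ℕ → ℕ → ℕ
chainBound K zero = 0
chainBound K (suc k) = 2 + K * chainBound K k

-- Ramsey's theorem

module _ {K : ℕ} where

  pigeonhole : {A : Set} (f : A → Fin K) (N : ℕ) (xs : List A) → K * N < length xs →
    ∃ λ c → N < length (filter (λ x → f x F.≟ c) xs)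
  pigeonhole f N xs large with Fin.any? (λ c → N <? length (filter (λ x → f x F.≟ c) xs))
  ... | yes found = found
  ... | no none = ⊥-elim (<⇒≱ large (begin
      length xs                                              ≡⟨ *-identityʳ _ ⟨
      length xs * 1                                          ≡⟨ ∑-const xs 1 ⟨
      ∑ xs (λ _ → 1)                                         ≤⟨ ∑-mono xs (λ {x} _ → colour x) ⟩
      ∑ xs (λ x → ∑ (allFin K) (λ c → 𝟙 (f x F.≟ c)))        ≡⟨ ∑-swap xs (allFin K) _ ⟩
      ∑ (allFin K) (λ c → ∑ xs (λ x → 𝟙 (f x F.≟ c)))        ≤⟨ ∑-mono (allFin K) (λ {c} _ → class c) ⟩
      ∑ (allFin K) (λ _ → N)                                 ≡⟨ ∑-const (allFin K) N ⟩
      length (allFin K) * N                                  ≡⟨ cong (_* N) (length-tabulate {n = K} id) ⟩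
      K * N                                                  ∎))
    where
    open ≤-Reasoning
    class : ∀ c → ∑ xs (λ x → 𝟙 (f x F.≟ c)) ≤ N
    class c = ≤-trans (≤-reflexive (∑-𝟙 (λ x → f x F.≟ c) xs)) (≮⇒≥ (λ p → none (c , p)))
    colour : ∀ x → 1 ≤ ∑ (allFin K) (λ c → 𝟙 (f x F.≟ c))
    colour x = ≤-trans (∈-length (∈-filter⁺ (f x F.≟_) (∈-allFin (f x)) refl))
                       (≤-reflexive (≡-sym (∑-𝟙 (f x F.≟_) (allFin K))))

  -- A list of elements, each coloured so that its colour is that of all the pairs it forms with later elements.
  chain : {A : Set} (col : A → A → Fin K) {P : A → A → Set} (k : ℕ) {xs : List A} → AllPairs P xs → chainBound K k ≤ length xs →
    Σ (List (A × Fin K)) λ zs → length zs ≡ k × (∀ {z} → z ∈ zs → proj₁ z ∈ xs) ×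
      AllPairs (λ a b → P (proj₁ a) (proj₁ b) × col (proj₁ a) (proj₁ b) ≡ proj₂ a) zs
  chain col zero _ _ = [] , refl , (λ ()) , []
  chain col (suc k) {x ∷ xs} (px ∷ pxs) (s≤s large) with pigeonhole (col x) (chainBound K k) xs large
  ... | c , many with chain col k (AllPairs.filter⁺ (λ y → col x y F.≟ c) pxs) (<⇒≤ many)
  ... | zs , len , sub , rs = (x , c) ∷ zs , cong suc len , sub′ ,
      All.tabulate (λ z∈ → let y∈ , e = ∈-filter⁻ (λ y → col x y F.≟ c) (sub z∈) in All.lookup px y∈ , e) ∷ rs
    where
    sub′ : ∀ {z} → z ∈ (x , c) ∷ zs → proj₁ z ∈ x ∷ xs
    sub′ (here refl) = here refl
    sub′ (there z∈) = there (proj₁ (∈-filter⁻ (λ y → col x y F.≟ c) (sub z∈)))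

abstract

  ramseyBound : ℕ → ℕ → ℕ
  ramseyBound K N = chainBound K (suc (K * N))

  -- In a chain of `suc (K * N)` elements more than `N` carry the same colour, which is then the
  -- colour of every pair of them. Carrying `P` along hands the distinctness of the given elements
  -- over to `ys`.
  ramsey : {K : ℕ} {A : Set} (col : A → A → Fin K) {P : A → A → Set} (N : ℕ) {xs : List A} → AllPairs P xs →
    ramseyBound K N ≤ length xs →
    ∃ λ c → Σ (List A) λ ys → N < length ys × AllPairs (λ a b → P a b × col a b ≡ c) ys
  ramsey {K} {A} col N ps large with chain col (suc (K * N)) ps large
  ... | zs , len , _ , rs with pigeonhole proj₂ N zs (≤-reflexive (≡-sym len))
  ... | c , many = c , map proj₁ ws , subst (N <_) (≡-sym (length-map proj₁ ws)) many ,
      AllPairs.map⁺ (recolour (AllPairs.filter⁺ same rs) (λ z∈ → proj₂ (∈-filter⁻ same {xs = zs} z∈)))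
    where
    same : (z : A × Fin K) → Dec (proj₂ z ≡ c)
    same z = proj₂ z F.≟ c
    ws : List (A × Fin K)
    ws = filter same zs
    recolour : ∀ {Q : A → A → Set} {ws : List (A × Fin K)} →
      AllPairs (λ a b → Q (proj₁ a) (proj₁ b) × col (proj₁ a) (proj₁ b) ≡ proj₂ a) ws →
      (∀ {z} → z ∈ ws → proj₂ z ≡ c) →
      AllPairs (λ a b → Q (proj₁ a) (proj₁ b) × col (proj₁ a) (proj₁ b) ≡ c) ws
    recolour [] _ = []
    recolour (r ∷ rs) h = All.map (λ { (q , e) → q , trans e (h (here refl)) }) r ∷ recolour rs (h ∘ there)

-- The parts and vertices of F.

module Parts {m : ℕ} (s : Fin (suc m) → ℕ) where

  V : Set
  V = KVert s

  _≟V_ : (x y : V) → Dec (x ≡ y)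
  _≟V_ = ≡-dec F._≟_ F._≟_

  p top order : ℕ
  p = sum (map (λ i → s (inject₁ i)) (allFin m))
  top = s (fromℕ m)
  order = p + top

  parts : List (Fin (suc m))
  parts = map inject₁ (allFin m) ++ [ fromℕ m ]

  ∈-parts : ∀ i → i ∈ parts
  ∈-parts i with view i
  ... | ‵fromℕ = ∈-++⁺ʳ (map inject₁ (allFin m)) (here refl)
  ... | ‵inj₁ {i = k} _ = ∈-++⁺ˡ (∈-map⁺ inject₁ (∈-allFin k))

  parts-unique : Unique parts
  parts-unique = Unique.++⁺ (Unique.map⁺ Fin.inject₁-injective (Unique.allFin⁺ m)) ([] ∷ []) disjoint
    where
    disjoint : ∀ {i} → i ∈ map inject₁ (allFin m) × i ∈ [ fromℕ m ] → ⊥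
    disjoint (i∈ , here refl) with ∈-map⁻ inject₁ i∈
    ... | k , _ , e = Fin.fromℕ≢inject₁ e

  part : ∀ i → List V
  part i = map (i ,_) (allFin (s i))

  length-part : ∀ i → length (part i) ≡ s i
  length-part i = trans (length-map {B = V} (i ,_) (allFin (s i))) (length-tabulate {n = s i} id)

  ∈-part⁻ : ∀ {i} {z : V} → z ∈ part i → proj₁ z ≡ i
  ∈-part⁻ {i} z∈ with ∈-map⁻ (i ,_) z∈
  ... | _ , _ , refl = refl

  vertices : List (Fin (suc m)) → List V
  vertices [] = []
  vertices (i ∷ is) = part i ++ vertices is

  ∈-vertices⁺ : ∀ {is} {z : V} → proj₁ z ∈ is → z ∈ vertices is
  ∈-vertices⁺ {i ∷ is} {_ , k} (here refl) = ∈-++⁺ˡ (∈-map⁺ (i ,_) (∈-allFin k))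
  ∈-vertices⁺ {i ∷ is} (there i∈) = ∈-++⁺ʳ (part i) (∈-vertices⁺ i∈)

  ∈-vertices⁻ : ∀ is {z : V} → z ∈ vertices is → proj₁ z ∈ is
  ∈-vertices⁻ (i ∷ is) z∈ with ∈-++⁻ (part i) z∈
  ... | inj₂ z∈is = there (∈-vertices⁻ is z∈is)
  ... | inj₁ z∈i = here (∈-part⁻ z∈i)

  vertices-unique : ∀ {is} → Unique is → Unique (vertices is)
  vertices-unique [] = []
  vertices-unique {i ∷ is} (i∉ ∷ u) =
    Unique.++⁺ (Unique.map⁺ (λ { refl → refl }) (Unique.allFin⁺ (s i))) (vertices-unique u) disjoint
    where
    disjoint : ∀ {z} → z ∈ part i × z ∈ vertices is → ⊥
    disjoint (z∈i , z∈is) = All.lookup i∉ (∈-vertices⁻ is z∈is) (≡-sym (∈-part⁻ z∈i))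

  length-vertices : ∀ is → length (vertices is) ≡ sum (map s is)
  length-vertices [] = refl
  length-vertices (i ∷ is) = trans (length-++ (part i)) (cong₂ _+_ (length-part i) (length-vertices is))

  vertices-order : length (vertices parts) ≡ order
  vertices-order = trans (length-vertices parts) (trans (cong sum (map-++ s (map inject₁ (allFin m)) [ fromℕ m ]))
    (trans (sum-++ (map s (map inject₁ (allFin m))) [ top ])
      (cong₂ _+_ (cong sum (≡-sym (map-∘ (allFin m)))) (+-identityʳ top))))

  out : Fin (suc m) → List (Fin (suc m))
  out j = filter (λ i → ¬? (i F.≟ j)) parts

  out-unique : ∀ j → Unique (vertices (out j))
  out-unique j = vertices-unique (Unique.filter⁺ _ parts-unique)

  ∈-out⁻ : ∀ j {z : V} → z ∈ vertices (out j) → proj₁ z ≢ j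
  ∈-out⁻ j z∈ = proj₂ (∈-filter⁻ (λ i → ¬? (i F.≟ j)) {xs = parts} (∈-vertices⁻ (out j) z∈))

  ∈-out⁺ : ∀ j {z : V} → proj₁ z ≢ j → z ∈ vertices (out j)
  ∈-out⁺ j z≢ = ∈-vertices⁺ (∈-filter⁺ (λ i → ¬? (i F.≟ j)) (∈-parts _) z≢)

  -- As no part exceeds `top`, this leaves at least `p` vertices outside any given part; both bounds
  -- rely on it.
  order-out : ∀ j → order ≤ length (vertices (out j)) + s j
  order-out j = begin
      order                                   ≡⟨ vertices-order ⟨
      length (vertices parts)                 ≤⟨ length-⊆ (vertices-unique parts-unique) cover ⟩
      length (vertices (j ∷ out j))           ≡⟨ length-++ (part j) ⟩
      length (part j) + length (vertices (out j))
                                              ≡⟨ cong (_+ length (vertices (out j))) (length-part j) ⟩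
      s j + length (vertices (out j))         ≡⟨ +-comm (s j) _ ⟩
      length (vertices (out j)) + s j         ∎
    where
    open ≤-Reasoning
    cover : ∀ {z} → z ∈ vertices parts → z ∈ vertices (j ∷ out j)
    cover {z} _ with proj₁ z F.≟ j
    ... | yes refl = ∈-vertices⁺ {j ∷ out j} (here refl)
    ... | no z≢ = ∈-++⁺ʳ (part j) (∈-out⁺ j z≢)

-- Copies of F created by adding an edge

addEdge⁻ : ∀ {n} (A : Fin n → Fin n → Bool) u v x y → addEdge A u v x y ≡ true →
  A x y ≡ true ⊎ (x ≡ u × y ≡ v) ⊎ (x ≡ v × y ≡ u)
addEdge⁻ A u v x y e with A x y | x F.≟ u | y F.≟ v | x F.≟ v | y F.≟ u
... | true  | _       | _       | _       | _       = inj₁ refl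
... | false | yes xu | yes yv | _       | _       = inj₂ (inj₁ (xu , yv))
... | false | yes _  | no _   | yes xv | yes yu = inj₂ (inj₂ (xv , yu))
... | false | no _   | _      | yes xv | yes yu = inj₂ (inj₂ (xv , yu))

true≢false : ∀ {b} → b ≡ true → b ≡ false → ⊥
true≢false refl ()

neighbours : ∀ {n} → Graph n → Fin n → List (Fin n)
neighbours {n} G u = filter (λ v → adj G u v Bool.≟ true) (allFin n)

module Lower {m : ℕ} (s : Fin (suc m) → ℕ) (s≤top : ∀ i → s i ≤ s (fromℕ m))
             (c : ℕ) (c+3 : c + 3 ≡ 2 * Parts.p s + Parts.top s)
             {n : ℕ} (G : Graph n) (low : Fin n → Bool) where

  open Parts s

  E : Fin n → Fin n → Bool
  E = adj G

  swapE : ∀ {u v} {b} → E u v ≡ b → E v u ≡ b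
  swapE {u} {v} e = trans (Graph.sym G v u) e

  nbrs NL NH : Fin n → List (Fin n)
  nbrs = neighbours G
  NL u = filter (λ v → low v Bool.≟ true) (nbrs u)
  NH u = filter (λ v → low v Bool.≟ false) (nbrs u)

  dL dH weight : Fin n → ℕ
  dL u = length (NL u)
  dH u = length (NH u)
  weight u = 2 * dH u + dL u

  ∈-nbrs : ∀ {u v} → E u v ≡ true → v ∈ nbrs u
  ∈-nbrs e = ∈-filter⁺ _ (∈-allFin _) e

  nbrs-∈ : ∀ {u v} → v ∈ nbrs u → E u v ≡ true
  nbrs-∈ {u} v∈ = proj₂ (∈-filter⁻ (λ v → E u v Bool.≟ true) {xs = allFin n} v∈)

  ∈-NH : ∀ {u v} → E u v ≡ true → low v ≡ false → v ∈ NH u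
  ∈-NH e l = ∈-filter⁺ _ (∈-nbrs e) l

  ∈-NL : ∀ {u v} → E u v ≡ true → low v ≡ true → v ∈ NL u
  ∈-NL e l = ∈-filter⁺ _ (∈-nbrs e) l

  -- A copy of F in G + uv that uses the new edge, recorded as an embedding in G of F minus the edge
  -- between `x₀` and `y₀`.
  record Copy (u v : Fin n) : Set where
    field
      φ : V → Fin n
      φ-inj : ∀ {x y} → φ x ≡ φ y → x ≡ y
      x₀ y₀ : V
      x₀≁y₀ : proj₁ x₀ ≢ proj₁ y₀
      φx₀ : φ x₀ ≡ u
      φy₀ : φ y₀ ≡ v
      edge : ∀ x y → proj₁ x ≢ proj₁ y → ¬ (x ≡ x₀ × y ≡ y₀) → ¬ (x ≡ y₀ × y ≡ x₀) → E (φ x) (φ y) ≡ true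

  flip-copy : ∀ {u v} → Copy u v → Copy v u
  flip-copy cp = record
    { φ = φ ; φ-inj = φ-inj ; x₀ = y₀ ; y₀ = x₀ ; x₀≁y₀ = x₀≁y₀ ∘ ≡-sym ; φx₀ = φy₀ ; φy₀ = φx₀
    ; edge = λ x y x≁y h₁ h₂ → edge x y x≁y h₂ h₁ }
    where open Copy cp

  -- If no two vertices of different parts are sent to `u` and `v` in this order, exchanging them
  -- excludes the reverse order too; then all edges of the copy are old and G contains F.
  copy : ¬ Contains V (KEdge s) E → ∀ {u v} → Contains V (KEdge s) (addEdge E u v) → Copy u v
  copy free {u} {v} (φ , φ-inj , edges)
    with Any.any? (λ x → Any.any? (λ y → ¬? (proj₁ x F.≟ proj₁ y) ×-dec (φ x F.≟ u) ×-dec (φ y F.≟ v))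
                                  (vertices parts)) (vertices parts)
  ... | no none = ⊥-elim (free (φ , φ-inj , old))
    where
    absent : ∀ x y → proj₁ x ≢ proj₁ y → φ x ≡ u → φ y ≡ v → ⊥
    absent x y x≁y e f = none (lose (∈-vertices⁺ (∈-parts _)) (lose (∈-vertices⁺ (∈-parts _)) (x≁y , e , f)))
    old : ∀ x y → KEdge s x y → E (φ x) (φ y) ≡ true
    old x y x≁y with addEdge⁻ E u v (φ x) (φ y) (edges x y x≁y)
    ... | inj₁ e = e
    ... | inj₂ (inj₁ (e , f)) = ⊥-elim (absent x y x≁y e f)
    ... | inj₂ (inj₂ (e , f)) = ⊥-elim (absent y x (x≁y ∘ ≡-sym) f e)
  ... | yes found with find found
  ... | x₀ , _ , found′ with find found′
  ... | y₀ , _ , x₀≁y₀ , φx₀ , φy₀ = record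
    { φ = φ ; φ-inj = φ-inj ; x₀ = x₀ ; y₀ = y₀ ; x₀≁y₀ = x₀≁y₀ ; φx₀ = φx₀ ; φy₀ = φy₀ ; edge = old }
    where
    old : ∀ x y → proj₁ x ≢ proj₁ y → ¬ (x ≡ x₀ × y ≡ y₀) → ¬ (x ≡ y₀ × y ≡ x₀) → E (φ x) (φ y) ≡ true
    old x y x≁y h₁ h₂ with addEdge⁻ E u v (φ x) (φ y) (edges x y x≁y)
    ... | inj₁ e = e
    ... | inj₂ (inj₁ (e , f)) = ⊥-elim (h₁ (φ-inj (trans e (≡-sym φx₀)) , φ-inj (trans f (≡-sym φy₀))))
    ... | inj₂ (inj₂ (e , f)) = ⊥-elim (h₂ (φ-inj (trans e (≡-sym φy₀)) , φ-inj (trans f (≡-sym φx₀))))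

  -- The copy of F in G + uv, when the part of u has no low vertex besides u.
  module Half {u v : Fin n} (cp : Copy u v) (q : ℕ) (qu : dH u ≡ q) (qv : dH v ≡ q)
              (noCommon : ∀ w → low w ≡ true → E u w ≡ true → E v w ≡ true → ⊥)
              (high : ∀ x → proj₁ x ≡ proj₁ (Copy.x₀ cp) → x ≢ Copy.x₀ cp → low (Copy.φ cp x) ≡ false)
              (clash : ∀ t → t < q → E (nth u (NH u) t) (nth v (NH v) t) ≡ true → ⊥) where
    open Copy cp

    i j : Fin (suc m)
    i = proj₁ x₀
    j = proj₁ y₀

    from-u : ∀ z → proj₁ z ≢ i → z ≢ y₀ → E u (φ z) ≡ true
    from-u z z≁i z≢y₀ = subst (λ w → E w (φ z) ≡ true) φx₀
      (edge x₀ z (z≁i ∘ ≡-sym) (z≢y₀ ∘ proj₂) (x₀≁y₀ ∘ cong proj₁ ∘ proj₁))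

    from-v : ∀ z → proj₁ z ≢ j → z ≢ x₀ → E v (φ z) ≡ true
    from-v z z≁j z≢x₀ = subst (λ w → E w (φ z) ≡ true) φy₀
      (edge y₀ z (z≁j ∘ ≡-sym) (x₀≁y₀ ∘ ≡-sym ∘ cong proj₁ ∘ proj₁) (z≢x₀ ∘ proj₂))

    -- A low image outside both parts would be a common low neighbour of `u` and `v`.
    out-high : ∀ z → proj₁ z ≢ j → z ≢ x₀ → low (φ z) ≡ false
    out-high z z≁j z≢x₀ with proj₁ z F.≟ i
    ... | yes z~i = high z z~i z≢x₀
    ... | no z≁i = ¬-not (λ l → noCommon (φ z) l (from-u z z≁i (z≁j ∘ cong proj₁)) (from-v z z≁j z≢x₀))

    out-NH : ∀ z → proj₁ z ≢ j → z ≢ x₀ → φ z ∈ NH v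
    out-NH z z≁j z≢x₀ = ∈-NH (from-v z z≁j z≢x₀) (out-high z z≁j z≢x₀)

    index : V → ℕ → Set
    index z t = (proj₁ z ≢ j × z ≢ x₀ × nth v (NH v) t ≡ φ z) ⊎ (proj₁ z ≡ j × z ≢ y₀ × nth u (NH u) t ≡ φ z)

    -- The image of z itself if it is u, v or a low neighbour of u; otherwise its position among the high
    -- neighbours of v or, if z lies in the part of v, of u.
    Code : V → Fin n ⊎ ℕ → Set
    Code z (inj₁ w) = φ z ≡ w
    Code z (inj₂ t) = t < q × index z t

    -- The real case is a position `t` shared by a vertex outside the part of `v` and one inside it.
    -- Their images are the `t`-th high neighbours of `v` and of `u`, and are adjacent because the
    -- two vertices lie in different parts, against `clash`.
    Code-inj : ∀ {a b y} → Code a y → Code b y → a ≡ b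
    Code-inj {y = inj₁ w} e f = φ-inj (trans e (≡-sym f))
    Code-inj {y = inj₂ t} (_ , inj₁ (_ , _ , e)) (_ , inj₁ (_ , _ , f)) = φ-inj (trans (≡-sym e) f)
    Code-inj {y = inj₂ t} (_ , inj₂ (_ , _ , e)) (_ , inj₂ (_ , _ , f)) = φ-inj (trans (≡-sym e) f)
    Code-inj {a} {b} {inj₂ t} (t< , inj₁ (a≁j , a≢x₀ , e)) (_ , inj₂ (b~j , b≢y₀ , f)) =
      ⊥-elim (clash t t< (cross a b t a≁j a≢x₀ b~j b≢y₀ e f))
      where
      cross : ∀ a b t → proj₁ a ≢ j → a ≢ x₀ → proj₁ b ≡ j → b ≢ y₀ → nth v (NH v) t ≡ φ a → nth u (NH u) t ≡ φ b →
        E (nth u (NH u) t) (nth v (NH v) t) ≡ true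
      cross a b t a≁j a≢x₀ b~j b≢y₀ e f rewrite e | f =
        edge b a (λ b~a → a≁j (trans (≡-sym b~a) b~j)) (λ { (refl , _) → x₀≁y₀ b~j }) (b≢y₀ ∘ proj₁)
    Code-inj {a} {b} {inj₂ t} (t< , inj₂ y) (_ , inj₁ x) =
      ≡-sym (Code-inj {b} {a} {inj₂ t} (t< , inj₁ x) (t< , inj₂ y))

    -- `W` is left open: `order-dL` takes the low neighbours of `u`, and `c<weight` the empty list.
    module _ (W : List (Fin n)) (inW : ∀ z → proj₁ z ≡ j → z ≢ y₀ → low (φ z) ≡ true → φ z ∈ W) where

      codes : List (Fin n ⊎ ℕ)
      codes = map inj₁ (u ∷ v ∷ W) ++ map inj₂ (upTo q)

      encode : ∀ z → ∃ λ y → y ∈ codes × Code z y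
      encode z with z ≟V x₀ | z ≟V y₀ | proj₁ z F.≟ j
      ... | yes refl | _ | _ = inj₁ u , here refl , φx₀
      ... | _ | yes refl | _ = inj₁ v , there (here refl) , φy₀
      ... | no z≢x₀ | no z≢y₀ | no z≁j with ∈-nth v (out-NH z z≁j z≢x₀)
      ... | t , t< , e = inj₂ t , ∈-++⁺ʳ (map inj₁ (u ∷ v ∷ W)) (∈-map⁺ inj₂ (∈-upTo⁺ t<q)) , t<q , inj₁ (z≁j , z≢x₀ , e)
        where
        t<q : t < q
        t<q = subst (t <_) qv t<
      encode z | no z≢x₀ | no z≢y₀ | yes z~j with low (φ z) in l
      ... | true = inj₁ (φ z) , ∈-++⁺ˡ (there (there (∈-map⁺ inj₁ (inW z z~j z≢y₀ l)))) , refl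
      ... | false with ∈-nth u (∈-NH (from-u z (λ z~i → x₀≁y₀ (trans (≡-sym z~i) z~j)) z≢y₀) l)
      ... | t , t< , e = inj₂ t , ∈-++⁺ʳ (map inj₁ (u ∷ v ∷ W)) (∈-map⁺ inj₂ (∈-upTo⁺ t<q)) , t<q , inj₂ (z~j , z≢y₀ , e)
        where
        t<q : t < q
        t<q = subst (t <_) qu t<

      order-codes : order ≤ 2 + length W + q
      order-codes = begin
          order                    ≡⟨ vertices-order ⟨
          length (vertices parts)  ≤⟨ length-≤ Code Code-inj (vertices-unique parts-unique) (λ {z} _ → encode z) ⟩
          length codes             ≡⟨ length-++ (map inj₁ (u ∷ v ∷ W)) ⟩
          length (map {B = Fin n ⊎ ℕ} inj₁ (u ∷ v ∷ W)) + length (map {B = Fin n ⊎ ℕ} inj₂ (upTo q))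
            ≡⟨ cong₂ _+_ (length-map inj₁ (u ∷ v ∷ W)) (trans (length-map inj₂ (upTo q)) (length-upTo q)) ⟩
          2 + length W + q         ∎
        where open ≤-Reasoning

    order-dL : order ≤ 2 + dL u + q
    order-dL = order-codes (NL u) (λ z z~j z≢y₀ l →
      ∈-NL (from-u z (λ z~i → x₀≁y₀ (trans (≡-sym z~i) z~j)) z≢y₀) l)

    out-∈ : ∀ z → proj₁ z ≢ j → φ z ∈ u ∷ NH v
    out-∈ z z≁j with z ≟V x₀
    ... | yes refl = here φx₀
    ... | no z≢x₀ = there (out-NH z z≁j z≢x₀)

    -- At least `p` vertices lie outside the part of `v`, and their images lie in `u ∷ NH v`, of
    -- length `1 + q`. `k` counts further elements of that list: none in `p≤1+q`, one in `c<weight`.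
    p-bound : ∀ {k} → k + length (vertices (out j)) ≤ 1 + q → k + p ≤ 1 + q
    p-bound {k} h = +-cancelʳ-≤ top (k + p) (1 + q) (begin
        k + p + top                            ≡⟨ +-assoc k p top ⟩
        k + order                              ≤⟨ +-monoʳ-≤ k (order-out j) ⟩
        k + (length (vertices (out j)) + s j)  ≡⟨ +-assoc k _ (s j) ⟨
        k + length (vertices (out j)) + s j    ≤⟨ +-mono-≤ h (s≤top j) ⟩
        1 + q + top                            ∎)
      where open ≤-Reasoning

    p≤1+q : p ≤ 1 + q
    p≤1+q = p-bound {0} (subst (λ l → length (vertices (out j)) ≤ suc l) qv
      (length-≤ (λ z w → φ z ≡ w) (λ e f → φ-inj (trans e (≡-sym f))) (out-unique j)
        (λ {z} z∈ → φ z , out-∈ z (∈-out⁻ j z∈) , refl)))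

    -- Adds `order-dL` to the hypothesis, `c + 3` being `order + p`. The 3 consists of the 2 for `u`
    -- and `v` in `order-dL` and the 1 for `u` in `u ∷ NH v`.
    weight-lower : ∀ k → k + p ≤ 1 + q → k + c ≤ weight u
    weight-lower k h = +-cancelʳ-≤ 3 (k + c) (weight u) (begin
        k + c + 3                          ≡⟨ +-assoc k c 3 ⟩
        k + (c + 3)                        ≡⟨ cong (k +_) c+3 ⟩
        k + (2 * p + top)                  ≡⟨ e₁ k p top ⟩
        p + top + (k + p)                  ≤⟨ +-mono-≤ order-dL h ⟩
        2 + dL u + q + (1 + q)             ≡⟨ e₂ (dL u) q ⟩
        2 * q + dL u + 3                   ≡⟨ cong (λ d → 2 * d + dL u + 3) qu ⟨
        weight u + 3                       ∎)
      where
      open ≤-Reasoning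
      e₁ : ∀ k p t → k + (2 * p + t) ≡ p + t + (k + p)
      e₁ = solve-∀
      e₂ : ∀ l q → 2 + l + q + (1 + q) ≡ 2 * q + l + 3
      e₂ = solve-∀

    c≤weight : c ≤ weight u
    c≤weight = weight-lower 0 p≤1+q

    -- If `h` is not the image of a vertex outside the part of `v`, it is one more element of
    -- `u ∷ NH v`, and `p-bound` gains one. Otherwise a count with `W` empty gives the gain.
    c<weight : E u v ≡ false → ∀ h → low h ≡ false → E v h ≡ true → E u h ≡ false →
      (∀ w → low w ≡ true → E u w ≡ true → E w h ≡ true → ⊥) → c < weight u
    c<weight u≁v h h-high v~h u≁h noPath with Any.any? (λ z → φ z F.≟ h) (vertices (out j))
    ... | no h∉φ = weight-lower 1 (p-bound {1} (subst (λ l → suc (length (vertices (out j))) ≤ suc l) qv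
        (subst (_≤ suc (dH v)) (cong suc (length-map φ (vertices (out j))))
          (length-⊆ (fresh ∷ Unique.map⁺ φ-inj (out-unique j)) sub))))
      where
      fresh : All (h ≢_) (map φ (vertices (out j)))
      fresh = All.tabulate (λ { w∈ refl → case-∈ (∈-map⁻ φ w∈) })
        where
        case-∈ : (∃ λ z → z ∈ vertices (out j) × h ≡ φ z) → ⊥
        case-∈ (z , z∈ , e) = h∉φ (lose z∈ (≡-sym e))
      sub : ∀ {w} → w ∈ h ∷ map φ (vertices (out j)) → w ∈ u ∷ NH v
      sub (here refl) = there (∈-NH v~h h-high)
      sub (there w∈) with ∈-map⁻ φ w∈
      ... | z , z∈ , refl = out-∈ z (∈-out⁻ j z∈)
    -- Let `h` be the image of `z`. As `u` and `h` are not adjacent, `z` lies in the part of `u`,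
    -- which thus has two vertices. Whatever lies in the part of `v` besides `y₀` is sent to a
    -- common neighbour of `u` and `h`, which is high by `noPath`.
    ... | yes found with find found
    ... | z , z∈ , refl = big
      where
      z≁j : proj₁ z ≢ j
      z≁j = ∈-out⁻ j z∈
      z≢x₀ : z ≢ x₀
      z≢x₀ refl = true≢false (swapE (subst (λ w → E v w ≡ true) φx₀ v~h)) u≁v
      z~i : proj₁ z ≡ i
      z~i with proj₁ z F.≟ i
      ... | yes e = e
      ... | no z≁i = ⊥-elim (true≢false (from-u z z≁i (z≁j ∘ cong proj₁)) u≁h)
      noLow : ∀ y → proj₁ y ≡ j → y ≢ y₀ → low (φ y) ≡ true → φ y ∈ []
      noLow y y~j y≢y₀ l = ⊥-elim (noPath (φ y) l
        (from-u y (λ y~i → x₀≁y₀ (trans (≡-sym y~i) y~j)) y≢y₀)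
        (edge y z (λ y~z → z≁j (trans (≡-sym y~z) y~j)) (λ { (refl , _) → x₀≁y₀ y~j }) (y≢y₀ ∘ proj₁)))
      unique : ∀ {k} → k < 2 → (a b : Fin k) → a ≡ b
      unique (s≤s (s≤s z≤n)) F.zero F.zero = refl
      two : ∀ {x y : V} → proj₁ x ≡ proj₁ y → x ≢ y → 2 ≤ s (proj₁ y)
      two {_ , a} {k , b} refl x≢y with 2 ≤? s k
      ... | yes h = h
      ... | no h = ⊥-elim (x≢y (cong (k ,_) (unique (≰⇒> h) a b)))
      big : c < weight u
      -- Now `order` is at most `2 + q`. Compared with `weight-lower`, using the order twice gains
      -- `top`, at least 2, and loses 1.
      big = +-cancelʳ-≤ 4 (suc c) (weight u) (begin
          suc c + 4                ≡⟨ e₁ c ⟩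
          c + 3 + 2                ≡⟨ cong (_+ 2) c+3 ⟩
          2 * p + top + 2          ≤⟨ +-monoʳ-≤ (2 * p + top) (≤-trans (two z~i z≢x₀) (s≤top i)) ⟩
          2 * p + top + top        ≡⟨ e₂ p top ⟩
          2 * order                ≤⟨ *-monoʳ-≤ 2 (order-codes [] noLow) ⟩
          2 * (2 + 0 + q)          ≡⟨ cong (λ d → 2 * (2 + 0 + d)) qu ⟨
          2 * (2 + 0 + dH u)       ≤⟨ m≤n+m _ (dL u) ⟩
          dL u + 2 * (2 + 0 + dH u) ≡⟨ e₃ (dL u) (dH u) ⟩
          weight u + 4             ∎)
        where
        open ≤-Reasoning
        e₁ : ∀ c → suc c + 4 ≡ c + 3 + 2
        e₁ = solve-∀
        e₂ : ∀ p t → 2 * p + t + t ≡ 2 * (p + t)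
        e₂ = solve-∀
        e₃ : ∀ l q → l + 2 * (2 + 0 + q) ≡ 2 * q + l + 4
        e₃ = solve-∀

-- The bounded number of exceptions

-- For a relation that points backwards, such as `Near b a`, it is the ball of the last element that
-- holds all the others.
AllPairs-last : {A : Set} {R : A → A → Set} {x : A} {xs : List A} → AllPairs R (x ∷ xs) →
  Σ A λ l → Σ (List A) λ ys → l ∈ x ∷ xs × length ys ≡ length xs × AllPairs R ys ×
    (∀ {y} → y ∈ ys → R y l) × (∀ {y} → y ∈ ys → y ∈ x ∷ xs)
AllPairs-last {x = x} {[]} _ = x , [] , here refl , refl , [] , (λ ()) , λ ()
AllPairs-last {x = x} {_ ∷ _} (r ∷ rs) with AllPairs-last rs
... | l , ys , l∈ , len , ps , toLast , sub = l , x ∷ ys , there l∈ , cong suc len ,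
  All.tabulate (λ y∈ → All.lookup r (sub y∈)) ∷ ps ,
  (λ { (here refl) → All.lookup r l∈ ; (there y∈) → toLast y∈ }) ,
  λ { (here refl) → here refl ; (there y∈) → there (sub y∈) }

length-concatMap-≤ : {A B : Set} (f : A → List B) (D : ℕ) → (∀ x → length (f x) ≤ D) →
  ∀ xs → length (concatMap f xs) ≤ D * length xs
length-concatMap-≤ f D h [] = z≤n
length-concatMap-≤ f D h (x ∷ xs) = begin
    length (f x ++ concatMap f xs)         ≡⟨ length-++ (f x) ⟩
    length (f x) + length (concatMap f xs) ≤⟨ +-mono-≤ (h x) (length-concatMap-≤ f D h xs) ⟩
    D + D * length xs                      ≡⟨ *-suc D (length xs) ⟨
    D * suc (length xs)                    ∎
  where open ≤-Reasoning

length-AllPairs-≤ : {A B : Set} (f : A → B) {xs : List A} (ys : List B) → AllPairs (λ a b → f a ≢ f b) xs →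
  (∀ {x} → x ∈ xs → f x ∈ ys) → length xs ≤ length ys
length-AllPairs-≤ f {xs} ys ps sub = subst (_≤ length ys) (length-map f xs) (length-⊆ (AllPairs.map⁺ ps) sub′)
  where
  sub′ : ∀ {y} → y ∈ map f xs → y ∈ ys
  sub′ y∈ with ∈-map⁻ f y∈
  ... | x , x∈ , refl = sub x∈

module Defects {m : ℕ} (s : Fin (suc m) → ℕ) (s≤top : ∀ i → s i ≤ s (fromℕ m))
               (c : ℕ) (c+3 : c + 3 ≡ 2 * Parts.p s + Parts.top s)
               {n : ℕ} (G : Graph n) (saturated : Saturated (KVert s) (KEdge s) G)
               (low : Fin n → Bool) (D : ℕ) (lowDegree : ∀ u → low u ≡ true → length (neighbours G u) ≤ D) where

  open Parts s
  open Lower s s≤top c c+3 G low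
  open DecMembership (F._≟_ {n}) using (_∈?_)

  -- Injectivity follows from adjacency: different positions carry adjacent, hence different,
  -- vertices, as G has no loops.
  clique : (d : Fin n) {w : List (Fin n)} → AllPairs (λ a b → E a b ≡ true) w → order ≤ length w → Contains V (KEdge s) E
  clique d {w} ps large = φ , inj , λ x y x≁y → joined x y (x≁y ∘ cong proj₁)
    where
    position : (z : V) → ∃ λ t → t < length (vertices parts) × nth z (vertices parts) t ≡ z
    position z = ∈-nth z (∈-vertices⁺ (∈-parts (proj₁ z)))
    pos : V → ℕ
    pos z = proj₁ (position z)
    pos< : ∀ z → pos z < length w
    pos< z = <-≤-trans (proj₁ (proj₂ (position z))) (≤-trans (≤-reflexive vertices-order) large)
    pos-inj : ∀ x y → pos x ≡ pos y → x ≡ y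
    pos-inj x y e = nth-injective (vertices parts) (proj₁ (proj₂ (position x))) (proj₂ (proj₂ (position x)))
      (subst (λ t → nth y (vertices parts) t ≡ y) (≡-sym e) (proj₂ (proj₂ (position y))))
    φ : V → Fin n
    φ z = nth d w (pos z)
    joined : ∀ x y → x ≢ y → E (φ x) (φ y) ≡ true
    joined x y x≢y with <-cmp (pos x) (pos y)
    ... | tri< lt _ _ = AllPairs-nth d ps lt (pos< y)
    ... | tri≈ _ e _ = ⊥-elim (x≢y (pos-inj x y e))
    ... | tri> _ _ gt = swapE (AllPairs-nth d ps gt (pos< x))
    inj : Injective _≡_ _≡_ φ
    inj {x} {y} e with x ≟V y
    ... | yes x≡y = x≡y
    ... | no x≢y = ⊥-elim (true≢false (joined x y x≢y) (subst (λ w → E (φ x) w ≡ false) e (irrefl G (φ x))))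

  lowNbrs : Fin n → List (Fin n)
  lowNbrs x = if low x then nbrs x else []

  -- The vertices reachable from u by a path of length at most k, all of whose vertices but the last are low.
  ball : ℕ → Fin n → List (Fin n)
  ball zero u = u ∷ []
  ball (suc k) u = ball k u ++ concatMap lowNbrs (ball k u)

  -- Only low vertices are expanded, and they have at most `D` neighbours, so each step multiplies
  -- the length by at most `suc D`.
  ball-length : ∀ k u → length (ball k u) ≤ suc D ^ k
  ball-length zero u = ≤-refl
  ball-length (suc k) u = begin
      length (ball k u ++ concatMap lowNbrs (ball k u))          ≡⟨ length-++ (ball k u) ⟩
      length (ball k u) + length (concatMap lowNbrs (ball k u))  ≤⟨ +-monoʳ-≤ _ (length-concatMap-≤ lowNbrs D few (ball k u)) ⟩
      suc D * length (ball k u)                                  ≤⟨ *-monoʳ-≤ (suc D) (ball-length k u) ⟩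
      suc D ^ suc k                                              ∎
    where
    open ≤-Reasoning
    few : ∀ x → length (lowNbrs x) ≤ D
    few x with low x in l
    ... | true = lowDegree x l
    ... | false = z≤n

  ball-⊂ : ∀ {k u x} → x ∈ ball k u → x ∈ ball (suc k) u
  ball-⊂ x∈ = ∈-++⁺ˡ x∈

  ball-step : ∀ {k u x y} → x ∈ ball k u → low x ≡ true → E x y ≡ true → y ∈ ball (suc k) u
  ball-step {k} {u} {x} {y} x∈ l e = ∈-++⁺ʳ (ball k u) (∈-concatMap⁺ lowNbrs (lose x∈ y∈))
    where
    y∈ : y ∈ lowNbrs x
    y∈ rewrite l = ∈-nbrs e

  -- Low vertices too light for the count, and high vertices to which some low neighbour may have nothing to give.
  Defect : Fin n → Set
  Defect z = ∃ λ u → low u ≡ true ×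
    ((u ≡ z × weight u < c) ⊎ (low z ≡ false × E u z ≡ true × weight u ≤ c))

  Defect? : ∀ z → Dec (Defect z)
  Defect? z = Fin.any? (λ u → (low u Bool.≟ true) ×-dec
    (((u F.≟ z) ×-dec (weight u <? c)) ⊎-dec ((low z Bool.≟ false) ×-dec (E u z Bool.≟ true) ×-dec (weight u ≤? c))))

  Item : Set
  Item = Σ (Fin n) Defect

  site base : Item → Fin n
  site (z , _) = z
  base (_ , u , _) = u

  base-low : ∀ a → low (base a) ≡ true
  base-low (_ , _ , l , _) = l

  base-weight : ∀ a → weight (base a) ≤ c
  base-weight (_ , _ , _ , inj₁ (_ , w)) = <⇒≤ w
  base-weight (_ , _ , _ , inj₂ (_ , _ , w)) = w

  -- A base is its site or a low neighbour of it, so a site outside the ball of radius 4 has its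
  -- base outside the ball of radius 3. This rules out an edge, a common low neighbour and a path
  -- through two low vertices between the bases.
  Near : Item → Item → Set
  Near a b = site b ∈ ball 4 (base a)

  base-far : ∀ a b → ¬ Near a b → ¬ base b ∈ ball 3 (base a)
  base-far a (_ , _ , _ , inj₁ (refl , _)) far = far ∘ ball-⊂ {3} {base a}
  base-far a (_ , _ , l , inj₂ (_ , e , _)) far u∈ = far (ball-step {3} {base a} u∈ l e)

  module Pair (a b : Item) (a↛b : ¬ Near a b) where

    u v : Fin n
    u = base a
    v = base b

    u∈ : u ∈ ball 0 u
    u∈ = here refl

    step₁ : ∀ {w} → E u w ≡ true → w ∈ ball 1 u
    step₁ e = ball-step {0} {u} u∈ (base-low a) e

    up : ∀ {x} → x ∈ ball 1 u → x ∈ ball 3 u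
    up = ball-⊂ {2} {u} ∘ ball-⊂ {1} {u}

    u≢v : u ≢ v
    u≢v e = base-far a b a↛b (up (ball-⊂ {0} {u} (subst (_∈ ball 0 u) e u∈)))

    u≁v : E u v ≡ false
    u≁v = ¬-not (λ e → base-far a b a↛b (up (step₁ e)))

    noCommon : ∀ w → low w ≡ true → E u w ≡ true → E v w ≡ true → ⊥
    noCommon w l e f = base-far a b a↛b (ball-⊂ {2} {u} (ball-step {1} {u} (step₁ e) l (swapE f)))

    noPath : ∀ w x → low w ≡ true → low x ≡ true → E u w ≡ true → E w x ≡ true → E v x ≡ true → ⊥
    noPath w x l k e f g = base-far a b a↛b (ball-step {2} {u} (ball-step {1} {u} (step₁ e) l f) k (swapE g))

    -- If `u` has weight below `c`, this contradicts `c≤weight`. Otherwise the site of `a` is high,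
    -- hence also that of `b`, which is then a high neighbour of `v` out of reach of `u`, and
    -- `c<weight` contradicts `weight u ≤ c`.
    half : (cp : Copy u v) → dH u ≡ dH v → low (site a) ≡ low (site b) →
      (∀ x → proj₁ x ≡ proj₁ (Copy.x₀ cp) → x ≢ Copy.x₀ cp → low (Copy.φ cp x) ≡ false) →
      (∀ t → t < dH v → E (nth u (NH u) t) (nth v (NH v) t) ≡ true → ⊥) → ⊥
    half cp d k high clash = cases a b refl refl
      where
      open Half cp (dH v) d refl noCommon high clash using (c≤weight; c<weight)
      cases : ∀ a′ b′ → a′ ≡ a → b′ ≡ b → ⊥
      cases (z , _ , _ , inj₁ (_ , w)) b′ refl _ = <⇒≱ w c≤weight
      cases (z , _ , _ , inj₂ (zl , _ , w)) (z′ , _ , l , inj₁ (refl , _)) refl refl = true≢false l (trans (≡-sym k) zl)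
      cases (z , _ , _ , inj₂ (_ , _ , w)) (z′ , _ , _ , inj₂ (zl , e , _)) refl refl =
        <⇒≱ (c<weight u≁v z′ zl e
          (¬-not (λ f → a↛b (ball-⊂ {3} {u} (up (step₁ f)))))
          (λ w l f g → a↛b (ball-⊂ {3} {u} (ball-⊂ {2} {u} (ball-step {1} {u} (step₁ f) l g))))) w

  -- If in the copy the parts of `u` and `v` had further low images `x` and `y`, then `u`, `y`, `x`,
  -- `v` would be a path through low vertices. So one part has none, and `half` applies to the copy
  -- or to its flip. Positions up to `c` suffice because `dH` is at most the weight.
  matched : ∀ a b → ¬ Near a b → ¬ Near b a → dH (base a) ≡ dH (base b) → low (site a) ≡ low (site b) →
    Σ (Fin (suc c)) λ t → E (nth (base a) (NH (base a)) (toℕ t)) (nth (base b) (NH (base b)) (toℕ t)) ≡ true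
  matched a b a↛b b↛a d k
    with Fin.any? {n = suc c} (λ t → E (nth (base a) (NH (base a)) (toℕ t)) (nth (base b) (NH (base b)) (toℕ t)) Bool.≟ true)
  ... | yes found = found
  ... | no none = ⊥-elim (contra (copy (proj₁ saturated) (proj₂ saturated u v AB.u≢v AB.u≁v)))
    where
    module AB = Pair a b a↛b
    module BA = Pair b a b↛a
    open AB using (u; v)
    dH≤c : dH v ≤ c
    dH≤c = ≤-trans (m≤m+n _ _) (≤-trans (m≤m+n _ _) (base-weight b))
    unmatched : ∀ t → t < dH v → E (nth u (NH u) t) (nth v (NH v) t) ≡ true → ⊥
    unmatched t t< e = none (F.fromℕ< t<c , subst (λ t → E (nth u (NH u) t) (nth v (NH v) t) ≡ true) (≡-sym (Fin.toℕ-fromℕ< t<c)) e)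
      where
      t<c : t < suc c
      t<c = <-≤-trans t< (m≤n⇒m≤1+n dH≤c)
    contra : Copy u v → ⊥
    contra cp with Any.any? (λ x → (proj₁ x F.≟ proj₁ (Copy.x₀ cp)) ×-dec (¬? (x ≟V Copy.x₀ cp)) ×-dec (low (Copy.φ cp x) Bool.≟ true))
                            (vertices parts)
    ... | no allHigh = AB.half cp d k
        (λ x x~ x≢ → ¬-not (λ l → allHigh (lose (∈-vertices⁺ (∈-parts _)) (x~ , x≢ , l)))) unmatched
    ... | yes found with find found
    ... | x , _ , x~i , x≢x₀ , x-low = BA.half (flip-copy cp) (≡-sym d) (≡-sym k) others
        (λ t t< e → unmatched t (subst (t <_) d t<) (swapE e))
      where
      open Copy cp
      others : ∀ y → proj₁ y ≡ proj₁ y₀ → y ≢ y₀ → low (φ y) ≡ false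
      others y y~j y≢y₀ = ¬-not (λ y-low → AB.noPath (φ y) (φ x) y-low x-low
        (subst (λ w → E w (φ y) ≡ true) φx₀
          (edge x₀ y (λ e → x₀≁y₀ (trans e y~j)) (y≢y₀ ∘ proj₂) (x₀≁y₀ ∘ cong proj₁ ∘ proj₁)))
        (edge y x (λ e → x₀≁y₀ (trans (≡-sym x~i) (trans (≡-sym e) y~j))) (λ { (refl , _) → x₀≁y₀ y~j }) (y≢y₀ ∘ proj₁))
        (subst (λ w → E w (φ x) ≡ true) φy₀
          (edge y₀ x (λ e → x₀≁y₀ (trans (≡-sym x~i) (≡-sym e))) (x₀≁y₀ ∘ ≡-sym ∘ cong proj₁ ∘ proj₁) (x≢x₀ ∘ proj₂))))

  K : ℕ
  K = 4 + suc c

  -- The colours of the Ramsey argument: one for each of the four ways to fail the hypotheses of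
  -- `matched`, and one for each position at which a pair can be matched.
  Related : Fin K → Item → Item → Set
  Related F.zero a b = Near a b
  Related (F.suc F.zero) a b = Near b a
  Related (F.suc (F.suc F.zero)) a b = dH (base a) ≢ dH (base b)
  Related (F.suc (F.suc (F.suc F.zero))) a b = low (site a) ≢ low (site b)
  Related (F.suc (F.suc (F.suc (F.suc t)))) a b =
    E (nth (base a) (NH (base a)) (toℕ t)) (nth (base b) (NH (base b)) (toℕ t)) ≡ true

  relate : ∀ a b → ∃ λ k → Related k a b
  relate a b with site b ∈? ball 4 (base a) | site a ∈? ball 4 (base b)
                | dH (base a) ≟ dH (base b) | low (site a) Bool.≟ low (site b)
  ... | yes r | _ | _ | _ = F.zero , r
  ... | no _ | yes r | _ | _ = F.suc F.zero , r
  ... | no _ | no _ | no r | _ = F.suc (F.suc F.zero) , r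
  ... | no _ | no _ | yes _ | no r = F.suc (F.suc (F.suc F.zero)) , r
  ... | no a↛b | no b↛a | yes d | yes k with matched a b a↛b b↛a d k
  ... | t , r = F.suc (F.suc (F.suc (F.suc t))) , r

  dH≤c : ∀ a → dH (base a) ≤ c
  dH≤c a = ≤-trans (m≤m+n _ _) (≤-trans (m≤m+n _ _) (base-weight a))

  items : ∀ {xs} → All Defect xs → List Item
  items [] = []
  items {x ∷ _} (d ∷ ds) = (x , d) ∷ items ds

  length-items : ∀ {xs} (ds : All Defect xs) → length (items ds) ≡ length xs
  length-items [] = refl
  length-items (_ ∷ ds) = cong suc (length-items ds)

  items-distinct : ∀ {xs} → Unique xs → (ds : All Defect xs) → AllPairs (λ a b → site a ≢ site b) (items ds)
  items-distinct [] [] = []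
  items-distinct (x∉ ∷ u) (_ ∷ ds) = spread x∉ ds ∷ items-distinct u ds
    where
    spread : ∀ {x xs} → All (x ≢_) xs → (ds : All Defect xs) → All (λ b → x ≢ site b) (items ds)
    spread [] [] = []
    spread (h ∷ hs) (_ ∷ ds) = h ∷ spread hs ds

  defects : List (Fin n)
  defects = filter Defect? (allFin n)

  module Homogeneous (N : ℕ) (N-ball : suc D ^ 4 < N) (N-c : suc c ≤ N) (N-2 : 2 ≤ N) (N-order : order ≤ N) where

    -- The first two colours crowd distinct sites into one ball, the next two need too many values
    -- of `dH` or `low`, and each of the others yields a clique on at least `order` vertices.
    homogeneous : ∀ k {ys} → AllPairs (λ a b → site a ≢ site b × Related k a b) ys → N < length ys → ⊥
    homogeneous F.zero {a ∷ ys} (r ∷ rs) (s≤s large) = <⇒≱ N-ball (≤-trans large (≤-trans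
      (length-AllPairs-≤ site (ball 4 (base a)) (AllPairs.map proj₁ rs) (λ y∈ → proj₂ (All.lookup r y∈)))
      (ball-length 4 (base a))))
    homogeneous (F.suc F.zero) {a ∷ ys} rs (s≤s large) with AllPairs-last rs
    ... | l , zs , _ , len , ps , near , _ = <⇒≱ N-ball (≤-trans (subst (N ≤_) (≡-sym len) large) (≤-trans
      (length-AllPairs-≤ site (ball 4 (base l)) (AllPairs.map proj₁ ps) (λ y∈ → proj₂ (near y∈)))
      (ball-length 4 (base l))))
    homogeneous (F.suc (F.suc F.zero)) {ys} rs large = <⇒≱ large (≤-trans
      (length-AllPairs-≤ (dH ∘ base) (upTo (suc c)) (AllPairs.map proj₂ rs) (λ {a} _ → ∈-upTo⁺ (s≤s (dH≤c a))))
      (≤-trans (≤-reflexive (length-upTo (suc c))) N-c))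
    homogeneous (F.suc (F.suc (F.suc F.zero))) {ys} rs large = <⇒≱ large (≤-trans
      (length-AllPairs-≤ (low ∘ site) (true ∷ false ∷ []) (AllPairs.map proj₂ rs) (λ {a} _ → bool (low (site a)))) N-2)
      where
      bool : ∀ b → b ∈ true ∷ false ∷ []
      bool true = here refl
      bool false = there (here refl)
    homogeneous (F.suc (F.suc (F.suc (F.suc t)))) {a ∷ ys} rs large =
      proj₁ saturated (clique (base a) {map f (a ∷ ys)} (AllPairs.map⁺ (AllPairs.map proj₂ rs))
        (≤-trans N-order (≤-trans (<⇒≤ large) (≤-reflexive (≡-sym (length-map f (a ∷ ys)))))))
      where
      f : Item → Fin n
      f a = nth (base a) (NH (base a)) (toℕ t)

    few-defects : length defects ≤ ramseyBound K N
    few-defects = ≮⇒≥ many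
      where
      ds : All Defect defects
      ds = All.tabulate (λ z∈ → proj₂ (∈-filter⁻ Defect? {xs = allFin n} z∈))
      many : ¬ ramseyBound K N < length defects
      many h with ramsey (λ a b → proj₁ (relate a b)) N (items-distinct (Unique.filter⁺ Defect? (Unique.allFin⁺ n)) ds)
                    (≤-trans (<⇒≤ h) (≤-reflexive (≡-sym (length-items ds))))
      ... | k , ys , large , rs = homogeneous k (AllPairs.map (λ { {a} {b} (d , e) → d , subst (λ k → Related k a b) e (proj₂ (relate a b)) }) rs) large

-- Discharging

<ᵇ-true : ∀ {a b} → (a <ᵇ b) ≡ true → a < b
<ᵇ-true {a} {b} e = <ᵇ⇒< a b (subst T (≡-sym e) _)

<ᵇ-false : ∀ {a b} → (a <ᵇ b) ≡ false → b ≤ a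
<ᵇ-false {a} {b} e = ≮⇒≥ (λ a<b → subst T e (<⇒<ᵇ a<b))

∑∑ : ∀ {n} → (Fin n → Fin n → ℕ) → ℕ
∑∑ {n} f = ∑ (allFin n) (λ i → ∑ (allFin n) (f i))

∑∑-cong : ∀ {n} {f g : Fin n → Fin n → ℕ} → (∀ i j → f i j ≡ g i j) → ∑∑ f ≡ ∑∑ g
∑∑-cong {n} h = ∑-cong (allFin n) (λ i → ∑-cong (allFin n) (h i))

∑∑-symmetrize : ∀ {n} (f : Fin n → Fin n → ℕ) → 2 * ∑∑ f ≡ ∑∑ (λ i j → f i j + f j i)
∑∑-symmetrize {n} f = begin
    2 * ∑∑ f                        ≡⟨ cong (∑∑ f +_) (+-identityʳ (∑∑ f)) ⟩
    ∑∑ f + ∑∑ f                     ≡⟨ cong (∑∑ f +_) (∑-swap (allFin n) (allFin n) f) ⟩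
    ∑∑ f + ∑∑ (λ i j → f j i)       ≡⟨ ∑-+ (allFin n) _ _ ⟨
    ∑ (allFin n) (λ i → ∑ (allFin n) (f i) + ∑ (allFin n) (λ j → f j i))
                                    ≡⟨ ∑-cong (allFin n) (λ i → ≡-sym (∑-+ (allFin n) _ _)) ⟩
    ∑∑ (λ i j → f i j + f j i)      ∎
  where open ≡-Reasoning

module _ {n : ℕ} (G : Graph n) where

  double-edgeCount : 2 * edgeCount G ≡ ∑∑ (λ i j → if adj G i j then 1 else 0)
  double-edgeCount = trans (∑∑-symmetrize below) (∑∑-cong both)
    where
    below : Fin n → Fin n → ℕ
    below i j = if (toℕ i <ᵇ toℕ j) ∧ adj G i j then 1 else 0
    both : ∀ i j → below i j + below j i ≡ (if adj G i j then 1 else 0)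
    both i j rewrite Graph.sym G j i with toℕ i <ᵇ toℕ j in p | toℕ j <ᵇ toℕ i in q
    ... | true | true = ⊥-elim (<-asym (<ᵇ-true {toℕ i} p) (<ᵇ-true {toℕ j} q))
    ... | true | false = +-identityʳ _
    ... | false | true = refl
    ... | false | false with Fin.toℕ-injective (≤-antisym (<ᵇ-false {toℕ j} q) (<ᵇ-false {toℕ i} p))
    ... | refl rewrite irrefl G i = refl

  -- Each edge has `2 * M` units to split between its ends, so every splitting has the same total.
  -- The equation is doubled in order to pair `w i j` with `w j i`.
  discharge : (M : ℕ) (w : Fin n → Fin n → ℕ) → (∀ i j → w i j + w j i ≡ 2 * M) →
    ∑ (allFin n) (λ i → ∑ (neighbours G i) (w i)) ≡ M * (2 * edgeCount G)
  discharge M w balanced = *-cancelˡ-≡ _ _ 2 (begin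
      2 * ∑ (allFin n) (λ i → ∑ (neighbours G i) (w i))
        ≡⟨ cong (2 *_) (∑-cong (allFin n) (λ i → ≡-sym (∑-filter (adj G i) (allFin n) (w i)))) ⟩
      2 * ∑∑ flow
        ≡⟨ ∑∑-symmetrize flow ⟩
      ∑∑ (λ i j → flow i j + flow j i)
        ≡⟨ ∑∑-cong pair ⟩
      ∑∑ (λ i j → 2 * M * 𝟙ₑ i j)
        ≡⟨ ∑-cong (allFin n) (λ i → ∑-* (allFin n) (2 * M) (𝟙ₑ i)) ⟩
      ∑ (allFin n) (λ i → 2 * M * ∑ (allFin n) (𝟙ₑ i))
        ≡⟨ ∑-* (allFin n) (2 * M) (λ i → ∑ (allFin n) (𝟙ₑ i)) ⟩
      2 * M * ∑∑ 𝟙ₑ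
        ≡⟨ cong (2 * M *_) double-edgeCount ⟨
      2 * M * (2 * edgeCount G)
        ≡⟨ *-assoc 2 M _ ⟩
      2 * (M * (2 * edgeCount G)) ∎)
    where
    open ≡-Reasoning
    flow 𝟙ₑ : Fin n → Fin n → ℕ
    flow i j = if adj G i j then w i j else 0
    𝟙ₑ i j = if adj G i j then 1 else 0
    pair : ∀ i j → flow i j + flow j i ≡ 2 * M * 𝟙ₑ i j
    pair i j rewrite Graph.sym G j i with adj G i j
    ... | true = trans (balanced i j) (≡-sym (*-identityʳ (2 * M)))
    ... | false = ≡-sym (*-zeroʳ (2 * M))

∑-lower-except : {A : Set} {P : A → Set} (P? : Decidable P) (k : ℕ) (f : A → ℕ) → (∀ x → ¬ P x → k ≤ f x) →
  ∀ xs → k * length xs ≤ ∑ xs f + k * length (filter P? xs)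
∑-lower-except P? k f h [] = ≤-trans (≤-reflexive (*-zeroʳ k)) z≤n
∑-lower-except P? k f h (x ∷ xs) with P? x
... | yes _ = begin
    k * suc (length xs)                              ≡⟨ *-suc k _ ⟩
    k + k * length xs                                ≤⟨ +-mono-≤ (m≤n+m k (f x)) (∑-lower-except P? k f h xs) ⟩
    f x + k + (∑ xs f + k * length (filter P? xs))   ≡⟨ interchange (f x) k _ _ ⟩
    f x + ∑ xs f + (k + k * length (filter P? xs))   ≡⟨ cong (f x + ∑ xs f +_) (*-suc k _) ⟨
    f x + ∑ xs f + k * suc (length (filter P? xs))   ∎
  where open ≤-Reasoning
... | no ¬p = begin
    k * suc (length xs)                              ≡⟨ *-suc k _ ⟩
    k + k * length xs                                ≤⟨ +-mono-≤ (h x ¬p) (∑-lower-except P? k f h xs) ⟩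
    f x + (∑ xs f + k * length (filter P? xs))       ≡⟨ +-assoc (f x) _ _ ⟨
    f x + ∑ xs f + k * length (filter P? xs)         ∎
  where open ≤-Reasoning

module Discharge {m : ℕ} (s : Fin (suc m) → ℕ) (s≤top : ∀ i → s i ≤ s (fromℕ m))
                 (c : ℕ) (c+3 : c + 3 ≡ 2 * Parts.p s + Parts.top s)
                 {n : ℕ} (G : Graph n) (saturated : Saturated (KVert s) (KEdge s) G)
                 (low : Fin n → Bool) (D : ℕ) (lowDegree : ∀ u → low u ≡ true → length (neighbours G u) ≤ D)
                 (highDegree : ∀ u → low u ≡ false → suc c * c ≤ length (neighbours G u)) where

  open Parts s using (order)
  open Lower s s≤top c c+3 G low using (dL; dH; weight; nbrs-∈)
  open Defects s s≤top c c+3 G saturated low D lowDegree hiding (K)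

  -- Scaling by `M` keeps charges integral: the target is `M * c` per vertex, and a surplus is
  -- passed on in single units.
  M : ℕ
  M = suc c

  τ : Fin n → ℕ
  τ u = if c <ᵇ weight u then 1 else 0

  -- An edge carries 2M units of charge. It splits them evenly, except that of an edge joining a low vertex
  -- to a high one the low end gets everything, or all but one unit if its weight exceeds c.
  charge : Fin n → Fin n → ℕ
  charge i j = if low i then (if low j then M else 2 * M ∸ τ i) else (if low j then τ j else M)

  τ≤2M : ∀ u → τ u ≤ 2 * M
  τ≤2M u with c <ᵇ weight u
  ... | true = s≤s z≤n
  ... | false = z≤n

  balanced : ∀ i j → charge i j + charge j i ≡ 2 * M
  balanced i j with low i | low j
  ... | true | true = cong (M +_) (≡-sym (+-identityʳ M))
  ... | true | false = m∸n+n≡m (τ≤2M i)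
  ... | false | true = m+[n∸m]≡n (τ≤2M j)
  ... | false | false = cong (M +_) (≡-sym (+-identityʳ M))

  received : Fin n → ℕ
  received i = ∑ (neighbours G i) (charge i)

  -- Every incident edge brings at least one unit, as a low neighbour of weight at most `c` would
  -- make `i` a defect; `highDegree` provides enough edges.
  received-high : ∀ i → ¬ Defect i → low i ≡ false → M * c ≤ received i
  received-high i good l = begin
      M * c                             ≤⟨ highDegree i l ⟩
      length (neighbours G i)           ≡⟨ *-identityʳ _ ⟨
      length (neighbours G i) * 1       ≡⟨ ∑-const (neighbours G i) 1 ⟨
      ∑ (neighbours G i) (λ _ → 1)      ≤⟨ ∑-mono (neighbours G i) one ⟩
      received i                        ∎
    where
    open ≤-Reasoning
    one : ∀ {j} → j ∈ neighbours G i → 1 ≤ charge i j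
    one {j} j∈ = subst (1 ≤_) (cong (λ x → if x then (if low j then M else 2 * M ∸ τ i) else (if low j then τ j else M)) (≡-sym l)) one′
      where
      one′ : 1 ≤ (if low j then τ j else M)
      one′ with low j in k
      ... | false = s≤s z≤n
      ... | true with c <ᵇ weight j in w
      ... | true = ≤-refl
      ... | false = ⊥-elim (good (j , k , inj₂ (l , trans (Graph.sym G j i) (nbrs-∈ j∈) , <ᵇ-false w)))

  -- `M` times the weight, less one unit for each of the `h` high neighbours. As `M` is `suc c`, `c`
  -- times the weight already reaches `M * c`, and the remaining copy of the weight pays the `h`
  -- units.
  surplus : ∀ l h → c < 2 * h + l → M * c ≤ M * l + (2 * M ∸ 1) * h
  surplus l h c< = +-cancelʳ-≤ (2 * h + l) _ _ (begin
      M * c + (2 * h + l)                        ≡⟨ +-comm (M * c) (2 * h + l) ⟩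
      2 * h + l + M * c                          ≡⟨ e₁ (2 * h + l) c ⟩
      2 * h + l + c * (1 + c)                    ≤⟨ +-monoʳ-≤ (2 * h + l) (*-monoʳ-≤ c c<) ⟩
      2 * h + l + c * (2 * h + l)                ≡⟨ e₂ l h c ⟩
      M * l + (2 * M ∸ 1) * h + h                ≤⟨ +-monoʳ-≤ (M * l + (2 * M ∸ 1) * h) (≤-trans (m≤m+n h _) (m≤m+n _ l)) ⟩
      M * l + (2 * M ∸ 1) * h + (2 * h + l)      ∎)
    where
    open ≤-Reasoning
    e₁ : ∀ y c → y + suc c * c ≡ y + c * (1 + c)
    e₁ = solve-∀
    e₂ : ∀ l h c → 2 * h + l + c * (2 * h + l) ≡ suc c * l + (c + suc (c + 0)) * h + h
    e₂ = solve-∀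

  received-low : ∀ i → ¬ Defect i → low i ≡ true → M * c ≤ received i
  received-low i good l = ≤-trans enough (≤-reflexive (≡-sym total))
    where
    total : received i ≡ M * dL i + (2 * M ∸ τ i) * dH i
    total rewrite l = ∑-split low (neighbours G i) M (2 * M ∸ τ i)
    enough : M * c ≤ M * dL i + (2 * M ∸ τ i) * dH i
    enough with c <ᵇ weight i in w
    ... | true = surplus (dL i) (dH i) (<ᵇ-true {c} w)
    ... | false = ≤-trans (*-monoʳ-≤ M (≮⇒≥ (λ w< → good (i , l , inj₁ (refl , w<))))) (≤-reflexive (e M (dL i) (dH i)))
      where
      e : ∀ M l h → M * (2 * h + l) ≡ M * l + 2 * M * h
      e = solve-∀

  received-all : ∀ i → ¬ Defect i → M * c ≤ received i
  received-all i good = cases (low i) refl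
    where
    cases : ∀ x → low i ≡ x → M * c ≤ received i
    cases true = received-low i good
    cases false = received-high i good

  lower : (N : ℕ) → suc D ^ 4 < N → suc c ≤ N → 2 ≤ N → order ≤ N →
    c * n ≤ 2 * edgeCount G + c * ramseyBound (4 + suc c) N
  lower N N-ball N-c N-2 N-order = *-cancelˡ-≤ M (begin
      M * (c * n)                                           ≡⟨ *-assoc M c n ⟨
      M * c * n                                             ≡⟨ cong (M * c *_) (length-tabulate {n = n} id) ⟨
      M * c * length (allFin n)                             ≤⟨ ∑-lower-except Defect? (M * c) received received-all (allFin n) ⟩
      ∑ (allFin n) received + M * c * length defects        ≡⟨ cong (_+ M * c * length defects) (discharge G M charge balanced) ⟩
      M * (2 * edgeCount G) + M * c * length defects        ≤⟨ +-monoʳ-≤ (M * (2 * edgeCount G)) (*-monoʳ-≤ (M * c) few) ⟩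
      M * (2 * edgeCount G) + M * c * ramseyBound (4 + suc c) N
                                                            ≡⟨ cong (M * (2 * edgeCount G) +_) (*-assoc M c _) ⟩
      M * (2 * edgeCount G) + M * (c * ramseyBound (4 + suc c) N)
                                                            ≡⟨ *-distribˡ-+ M (2 * edgeCount G) _ ⟨
      M * (2 * edgeCount G + c * ramseyBound (4 + suc c) N) ∎)
    where
    open ≤-Reasoning
    few : length defects ≤ ramseyBound (4 + suc c) N
    few = Homogeneous.few-defects N N-ball N-c N-2 N-order

-- The extremal graphs

addEdge-old : ∀ {n} (A : Fin n → Fin n → Bool) u v x y → A x y ≡ true → addEdge A u v x y ≡ true
addEdge-old A u v x y e rewrite e = refl

addEdge-new : ∀ {n} (A : Fin n → Fin n → Bool) u v → addEdge A u v u v ≡ true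
addEdge-new A u v with u F.≟ u | v F.≟ v
... | yes _ | yes _ = ∨-zeroʳ (A u v)
... | no h | _ = ⊥-elim (h refl)
... | yes _ | no h = ⊥-elim (h refl)

addEdge-new′ : ∀ {n} (A : Fin n → Fin n → Bool) u v → addEdge A u v v u ≡ true
addEdge-new′ A u v with u F.≟ u | v F.≟ v
... | no h | _ = ⊥-elim (h refl)
... | yes _ | no h = ⊥-elim (h refl)
... | yes _ | yes _ = trans (cong (A v u ∨_) (∨-zeroʳ _)) (∨-zeroʳ (A v u))

addEdge-flip : ∀ {n} (A : Fin n → Fin n → Bool) u v x y → addEdge A u v x y ≡ true → addEdge A v u x y ≡ true
addEdge-flip A u v x y e with addEdge⁻ A u v x y e
... | inj₁ h = addEdge-old A v u x y h
... | inj₂ (inj₁ (refl , refl)) = addEdge-new′ A v u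
... | inj₂ (inj₂ (refl , refl)) = addEdge-new A v u

-- K_h joined to disjoint cliques of order suc b, the last of which may be incomplete.
module HubsAndBlocks (h b n : ℕ) where

  Hub : Fin n → Set
  Hub i = toℕ i < h

  -- Truncated subtraction puts the hubs in block 0 as well, which is why `Mate` excludes them
  -- explicitly.
  block : Fin n → ℕ
  block i = (toℕ i ∸ h) / suc b

  Joined : Fin n → Fin n → Set
  Joined i j = i ≢ j × (Hub i ⊎ Hub j ⊎ block i ≡ block j)

  joined? : ∀ i j → Dec (Joined i j)
  joined? i j = ¬? (i F.≟ j) ×-dec ((toℕ i <? h) ⊎-dec ((toℕ j <? h) ⊎-dec (block i ≟ block j)))

  Joined-sym : ∀ {i j} → Joined i j → Joined j i
  Joined-sym (i≢j , inj₁ p) = i≢j ∘ ≡-sym , inj₂ (inj₁ p)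
  Joined-sym (i≢j , inj₂ (inj₁ p)) = i≢j ∘ ≡-sym , inj₁ p
  Joined-sym (i≢j , inj₂ (inj₂ p)) = i≢j ∘ ≡-sym , inj₂ (inj₂ (≡-sym p))

  ⌊⌋-sym : ∀ i j → ⌊ joined? i j ⌋ ≡ ⌊ joined? j i ⌋
  ⌊⌋-sym i j with joined? i j | joined? j i
  ... | yes _ | yes _ = refl
  ... | no _ | no _ = refl
  ... | yes p | no q = ⊥-elim (q (Joined-sym p))
  ... | no p | yes q = ⊥-elim (p (Joined-sym q))

  ⌊⌋-irrefl : ∀ i → ⌊ joined? i i ⌋ ≡ false
  ⌊⌋-irrefl i with joined? i i
  ... | yes p = ⊥-elim (proj₁ p refl)
  ... | no _ = refl

  graph : Graph n
  graph = record { adj = λ i j → ⌊ joined? i j ⌋ ; sym = ⌊⌋-sym ; irrefl = ⌊⌋-irrefl }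

  adj⁺ : ∀ {i j} → Joined i j → adj graph i j ≡ true
  adj⁺ {i} {j} p with joined? i j
  ... | yes _ = refl
  ... | no q = ⊥-elim (q p)

  adj⁻ : ∀ {i j} → adj graph i j ≡ true → Joined i j
  adj⁻ {i} {j} e with joined? i j
  ... | yes p = p

  adj-false : ∀ {i j} → adj graph i j ≡ false → ¬ Joined i j
  adj-false e p = true≢false (adj⁺ p) e

  place : ℕ → ℕ → ℕ
  place k r = h + k * suc b + r

  -- Natural numbers instead of vertices, as the last block may extend past `n`.
  members : ℕ → List ℕ
  members k = map (place k) (upTo (suc b))

  length-members : ∀ k → length (members k) ≡ suc b
  length-members k = trans (length-map (place k) (upTo (suc b))) (length-upTo (suc b))

  place-block : ∀ {i} → ¬ Hub i → ∃ λ r → r < suc b × toℕ i ≡ place (block i) r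
  place-block {i} i∉ = x % suc b , m%n<n x (suc b) , (begin
      toℕ i                                  ≡⟨ m+[n∸m]≡n (≮⇒≥ i∉) ⟨
      h + x                                  ≡⟨ cong (h +_) (m≡m%n+[m/n]*n x (suc b)) ⟩
      h + (x % suc b + block i * suc b)      ≡⟨ e h (x % suc b) (block i * suc b) ⟩
      place (block i) (x % suc b)            ∎)
    where
    open ≡-Reasoning
    x : ℕ
    x = toℕ i ∸ h
    e : ∀ a b c → a + (b + c) ≡ a + c + b
    e = solve-∀

  ∈-members : ∀ {i} → ¬ Hub i → toℕ i ∈ members (block i)
  ∈-members {i} i∉ with place-block i∉
  ... | r , r< , e = subst (_∈ members (block i)) (≡-sym e) (∈-map⁺ (place (block i)) (∈-upTo⁺ r<))

  block-place : ∀ {i k r} → r < suc b → toℕ i ≡ place k r → block i ≡ k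
  block-place {i} {k} {r} r< e = begin
      (toℕ i ∸ h) / suc b           ≡⟨ cong (λ x → (x ∸ h) / suc b) (trans e (+-assoc h _ r)) ⟩
      (h + (k * suc b + r) ∸ h) / suc b ≡⟨ cong (_/ suc b) (m+n∸m≡n h _) ⟩
      (k * suc b + r) / suc b       ≡⟨ cong (_/ suc b) (+-comm (k * suc b) r) ⟩
      (r + k * suc b) / suc b       ≡⟨ +-distrib-/-∣ʳ r (n∣m*n k) ⟩
      r / suc b + k * suc b / suc b ≡⟨ cong₂ _+_ (m<n⇒m/n≡0 r<) (m*n/n≡m k (suc b)) ⟩
      k                             ∎
    where open ≡-Reasoning

  Mate : Fin n → Fin n → Set
  Mate i j = i ≢ j × ¬ Hub i × ¬ Hub j × block i ≡ block j

  mate? : ∀ i j → Dec (Mate i j)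
  mate? i j = ¬? (i F.≟ j) ×-dec (¬? (toℕ i <? h) ×-dec (¬? (toℕ j <? h) ×-dec (block i ≟ block j)))

  hub? : ∀ i → Dec (Hub i)
  hub? i = toℕ i <? h

  few-hubs : ∑ (allFin n) (λ i → 𝟙 (hub? i)) ≤ h
  few-hubs = begin
      ∑ (allFin n) (λ i → 𝟙 (hub? i)) ≡⟨ ∑-𝟙 hub? (allFin n) ⟩
      length (filter hub? (allFin n)) ≤⟨ length-≤ (λ i k → toℕ i ≡ k) (λ p q → Fin.toℕ-injective (trans p (≡-sym q)))
                                           (Unique.filter⁺ hub? (Unique.allFin⁺ n))
                                           (λ i∈ → _ , ∈-upTo⁺ (proj₂ (∈-filter⁻ hub? {xs = allFin n} i∈)) , refl) ⟩
      length (upTo h)                 ≡⟨ length-upTo h ⟩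
      h                               ∎
    where open ≤-Reasoning

  few-mates : ∀ i → ∑ (allFin n) (λ j → 𝟙 (mate? i j)) ≤ b
  few-mates i = ≤-trans (≤-reflexive (∑-𝟙 (mate? i) (allFin n))) bound
    where
    mates : List (Fin n)
    mates = filter (mate? i) (allFin n)
    mates⁻ : ∀ {j} → j ∈ mates → Mate i j
    mates⁻ j∈ = proj₂ (∈-filter⁻ (mate? i) {xs = allFin n} j∈)
    nonhub : ¬ Hub i → length mates ≤ b
    nonhub i∉ = ≤-pred (≤-trans (length-≤ (λ i k → toℕ i ≡ k) (λ p q → Fin.toℕ-injective (trans p (≡-sym q)))
        (All.tabulate (λ j∈ → proj₁ (mates⁻ j∈)) ∷ Unique.filter⁺ (mate? i) (Unique.allFin⁺ n)) into)
        (≤-reflexive (length-members (block i))))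
      where
      into : ∀ {j} → j ∈ i ∷ mates → ∃ λ k → k ∈ members (block i) × toℕ j ≡ k
      into (here refl) = _ , ∈-members i∉ , refl
      into {j} (there j∈) with mates⁻ j∈
      ... | _ , _ , j∉ , e = _ , subst (λ k → toℕ j ∈ members k) (≡-sym e) (∈-members j∉) , refl
    cases : Dec (Hub i) → length mates ≤ b
    cases (no i∉) = nonhub i∉
    cases (yes i-hub) = ≤-trans (length-⊆ {ys = []} (Unique.filter⁺ (mate? i) (Unique.allFin⁺ n))
      (λ j∈ → ⊥-elim (proj₁ (proj₂ (mates⁻ j∈)) i-hub))) z≤n
    bound : length mates ≤ b
    bound = cases (hub? i)

  -- In an ordered adjacent pair the first is a hub, or the second is, or they are mates. These
  -- cases contribute at most `n * h`, `n * h` and `n * b`.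
  edges-≤ : 2 * edgeCount graph ≤ (2 * h + b) * n
  edges-≤ = begin
      2 * edgeCount graph                                      ≡⟨ double-edgeCount graph ⟩
      ∑∑ (λ i j → if adj graph i j then 1 else 0)              ≤⟨ ∑-mono V (λ {i} _ → ∑-mono V (λ {j} _ → pointwise i j)) ⟩
      ∑∑ (λ i j → 𝟙 (hub? i) + (𝟙 (hub? j) + 𝟙 (mate? i j)))   ≤⟨ ∑-mono V (λ {i} _ → row i) ⟩
      ∑ V (λ i → n * 𝟙 (hub? i) + (h + b))                     ≡⟨ ∑-+ V _ _ ⟩
      ∑ V (λ i → n * 𝟙 (hub? i)) + ∑ V (λ _ → h + b)           ≡⟨ cong₂ _+_ (∑-* V n _) (trans (∑-const V (h + b)) (cong (_* (h + b)) len)) ⟩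
      n * ∑ V (λ i → 𝟙 (hub? i)) + n * (h + b)                 ≤⟨ +-monoˡ-≤ (n * (h + b)) (*-monoʳ-≤ n few-hubs) ⟩
      n * h + n * (h + b)                                      ≡⟨ e n h b ⟩
      (2 * h + b) * n                                          ∎
    where
    open ≤-Reasoning
    V : List (Fin n)
    V = allFin n
    len : length V ≡ n
    len = length-tabulate {n = n} id
    e : ∀ n h b → n * h + n * (h + b) ≡ (2 * h + b) * n
    e = solve-∀
    row : ∀ i → ∑ V (λ j → 𝟙 (hub? i) + (𝟙 (hub? j) + 𝟙 (mate? i j))) ≤ n * 𝟙 (hub? i) + (h + b)
    row i = begin
        ∑ V (λ j → 𝟙 (hub? i) + (𝟙 (hub? j) + 𝟙 (mate? i j)))               ≡⟨ ∑-+ V _ _ ⟩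
        ∑ V (λ _ → 𝟙 (hub? i)) + ∑ V (λ j → 𝟙 (hub? j) + 𝟙 (mate? i j))     ≡⟨ cong₂ _+_ (trans (∑-const V _) (cong (_* 𝟙 (hub? i)) len)) (∑-+ V _ _) ⟩
        n * 𝟙 (hub? i) + (∑ V (λ j → 𝟙 (hub? j)) + ∑ V (λ j → 𝟙 (mate? i j))) ≤⟨ +-monoʳ-≤ (n * 𝟙 (hub? i)) (+-mono-≤ few-hubs (few-mates i)) ⟩
        n * 𝟙 (hub? i) + (h + b)                                            ∎
    covered : ∀ {i j} → Joined i j → (p : Dec (Hub i)) (q : Dec (Hub j)) (r : Dec (Mate i j)) → 1 ≤ 𝟙 p + (𝟙 q + 𝟙 r)
    covered _ (yes _) _ _ = s≤s z≤n
    covered _ (no _) (yes _) _ = s≤s z≤n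
    covered _ (no _) (no _) (yes _) = s≤s z≤n
    covered (_ , inj₁ p) (no i∉) (no _) (no _) = ⊥-elim (i∉ p)
    covered (_ , inj₂ (inj₁ p)) (no _) (no j∉) (no _) = ⊥-elim (j∉ p)
    covered (i≢j , inj₂ (inj₂ e)) (no i∉) (no j∉) (no none) = ⊥-elim (none (i≢j , i∉ , j∉ , e))
    pointwise : ∀ i j → (if adj graph i j then 1 else 0) ≤ 𝟙 (hub? i) + (𝟙 (hub? j) + 𝟙 (mate? i j))
    pointwise i j = indicator (adj graph i j) (λ a → covered (adj⁻ {i} {j} a) (hub? i) (hub? j) (mate? i j))
      where
      indicator : ∀ a {k} → (a ≡ true → 1 ≤ k) → (if a then 1 else 0) ≤ k
      indicator true f = f refl
      indicator false _ = z≤n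

-- Saturation of the extremal graphs.

module UpperBound {m : ℕ} (s : Fin (suc m) → ℕ) (s≤top : ∀ i → s i ≤ s (fromℕ m))
                  (h b : ℕ) (p≡ : Parts.p s ≡ suc h) (top≡ : Parts.top s ≡ suc b) (n : ℕ) where

  open Parts s
  open HubsAndBlocks h b n

  order≡ : order ≡ suc h + suc b
  order≡ = cong₂ _+_ p≡ top≡

  -- If vertices of two parts miss the hubs, the copy fits into the hubs and one block; if those of
  -- only one part do, the hubs hold all other parts. Either way there is room for at most
  -- `h + suc b` vertices, one fewer than `order`.
  free : ¬ Contains V (KEdge s) (adj graph)
  free (φ , φ-inj , edges) = too-few-hubs (λ z z∉ → in-one-part z z∉)
    where
    toℕφ-inj : ∀ {x y k} → toℕ (φ x) ≡ k → toℕ (φ y) ≡ k → x ≡ y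
    toℕφ-inj e f = φ-inj (Fin.toℕ-injective (trans e (≡-sym f)))
    same-block : ∀ {x y} → ¬ Hub (φ x) → ¬ Hub (φ y) → proj₁ x ≢ proj₁ y → block (φ x) ≡ block (φ y)
    same-block {x} {y} x∉ y∉ x≁y with adj⁻ (edges x y x≁y)
    ... | _ , inj₁ p = ⊥-elim (x∉ p)
    ... | _ , inj₂ (inj₁ p) = ⊥-elim (y∉ p)
    ... | _ , inj₂ (inj₂ e) = e
    in-two-parts : ∀ x y → ¬ Hub (φ x) → ¬ Hub (φ y) → proj₁ x ≢ proj₁ y → ⊥
    in-two-parts x y x∉ y∉ x≁y = <⇒≱ {h + suc b} (≤-reflexive (≡-sym order≡)) (begin
        order                                        ≡⟨ vertices-order ⟨
        length (vertices parts)                      ≤⟨ length-≤ (λ z k → toℕ (φ z) ≡ k) toℕφ-inj (vertices-unique parts-unique) (λ {z} _ → _ , into z , refl) ⟩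
        length (upTo h ++ members (block (φ x)))     ≡⟨ length-++ (upTo h) ⟩
        length (upTo h) + length (members (block (φ x))) ≡⟨ cong₂ _+_ (length-upTo h) (length-members (block (φ x))) ⟩
        h + suc b                                    ∎)
      where
      open ≤-Reasoning
      block≡ : ∀ z → ¬ Hub (φ z) → block (φ z) ≡ block (φ x)
      block≡ z z∉ with proj₁ z F.≟ proj₁ x
      ... | no z≁x = same-block z∉ x∉ z≁x
      -- Within the part of `x`, the blocks are compared through `y`, which lies in another part.
      ... | yes z~x = trans (same-block z∉ y∉ (λ z~y → x≁y (trans (≡-sym z~x) z~y))) (≡-sym (same-block x∉ y∉ x≁y))
      into : ∀ z → toℕ (φ z) ∈ upTo h ++ members (block (φ x))
      into z with hub? (φ z)
      ... | yes p = ∈-++⁺ˡ (∈-upTo⁺ p)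
      ... | no z∉ = ∈-++⁺ʳ (upTo h) (subst (λ k → toℕ (φ z) ∈ members k) (block≡ z z∉) (∈-members z∉))
    hub-bound : ∀ {zs} → Unique zs → (∀ {z} → z ∈ zs → Hub (φ z)) → length zs ≤ h
    hub-bound {zs} u hubs = subst (length zs ≤_) (length-upTo h)
      (length-≤ (λ z k → toℕ (φ z) ≡ k) toℕφ-inj u (λ z∈ → _ , ∈-upTo⁺ (hubs z∈) , refl))
    in-one-part : ∀ x → ¬ Hub (φ x) → ⊥
    in-one-part x x∉ = <⇒≱ {h + suc b} (≤-reflexive (≡-sym order≡)) (begin
        order                                            ≤⟨ order-out (proj₁ x) ⟩
        length (vertices (out (proj₁ x))) + s (proj₁ x)  ≤⟨ +-mono-≤ (hub-bound (out-unique (proj₁ x)) others) (≤-trans (s≤top (proj₁ x)) (≤-reflexive top≡)) ⟩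
        h + suc b                                        ∎)
      where
      open ≤-Reasoning
      others : ∀ {z} → z ∈ vertices (out (proj₁ x)) → Hub (φ z)
      others {z} z∈ with hub? (φ z)
      ... | yes p = p
      ... | no z∉ = ⊥-elim (in-two-parts z x z∉ x∉ (∈-out⁻ (proj₁ x) z∈))
    too-few-hubs : (∀ z → ¬ Hub (φ z) → ⊥) → ⊥
    too-few-hubs none = <⇒≱ {h} (≤-trans (m≤m+n (suc h) (suc b)) (≤-reflexive (≡-sym order≡)))
      (≤-trans (≤-reflexive (≡-sym vertices-order)) (hub-bound (vertices-unique parts-unique) (λ {z} _ → hub z)))
      where
      hub : ∀ z → Hub (φ z)
      hub z with hub? (φ z)
      ... | yes p = p
      ... | no z∉ = ⊥-elim (none z z∉)

  small : List (Fin (suc m))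
  small = map inject₁ (allFin m)

  length-small : length (vertices small) ≡ suc h
  length-small = trans (length-vertices small) (trans (cong sum (≡-sym (map-∘ (allFin m)))) p≡)

  ∈-small : ∀ {z : V} → proj₁ z ≢ fromℕ m → z ∈ vertices small
  ∈-small {z} z≢ = ∈-vertices⁺ {small} (helper (view (proj₁ z)) z≢)
    where
    helper : ∀ {i} → View i → i ≢ fromℕ m → i ∈ small
    helper ‵fromℕ i≢ = ⊥-elim (i≢ refl)
    helper (‵inj₁ {i = k} _) _ = ∈-map⁺ inject₁ (∈-allFin k)

  -- As block u < block v, the block of u is complete.
  module Extension (u v : Fin n) (u∉ : ¬ Hub u) (v∉ : ¬ Hub v) (u<v : block u < block v) where

    u≢v : u ≢ v
    u≢v refl = <-irrefl refl u<v

    h≤n : ∀ {e} → e < h → e < n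
    h≤n e<h = <-≤-trans e<h (≤-trans (≮⇒≥ u∉) (<⇒≤ (Fin.toℕ<n u)))

    place<n : ∀ r → r < suc b → place (block u) r < n
    place<n r r< with place-block v∉
    ... | r′ , _ , e = ≤-<-trans (begin
        h + block u * suc b + r          ≤⟨ +-monoʳ-≤ (h + block u * suc b) (<⇒≤ r<) ⟩
        h + block u * suc b + suc b      ≡⟨ +-assoc h _ _ ⟩
        h + (block u * suc b + suc b)    ≡⟨ cong (h +_) (+-comm (block u * suc b) (suc b)) ⟩
        h + suc (block u) * suc b        ≤⟨ +-monoʳ-≤ h (*-monoˡ-≤ (suc b) u<v) ⟩
        h + block v * suc b              ≤⟨ m≤m+n _ r′ ⟩
        place (block v) r′               ≡⟨ e ⟨
        toℕ v                            ∎) (Fin.toℕ<n v)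
      where open ≤-Reasoning

    -- The first `h` vertices outside the last part go to the hubs and the remaining one to `u`, the
    -- centre of the star. The last part fills the block of `u`, with `v` replacing `u` itself.
    data Image (z : V) (w : Fin n) : Set where
      hub : (e : ℕ) → e < h → toℕ w ≡ e → nth z (vertices small) e ≡ z → Image z w
      centre : nth z (vertices small) h ≡ z → w ≡ u → Image z w
      leaf : (k : Fin top) → z ≡ (fromℕ m , k) → toℕ w ≡ place (block u) (toℕ k) → w ≢ u → Image z w
      newLeaf : (k : Fin top) → z ≡ (fromℕ m , k) → toℕ u ≡ place (block u) (toℕ k) → w ≡ v → Image z w

    image : ∀ z → ∃ (Image z)
    image (i , k) with i F.≟ fromℕ m
    ... | yes refl = leafImage (toℕ u ≟ place (block u) (toℕ k))
      where
      k< : toℕ k < suc b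
      k< = subst (toℕ k <_) top≡ (Fin.toℕ<n k)
      leafImage : Dec (toℕ u ≡ place (block u) (toℕ k)) → ∃ (Image (fromℕ m , k))
      leafImage (yes e) = v , newLeaf k refl e refl
      leafImage (no e) = F.fromℕ< (place<n (toℕ k) k<) , leaf k refl (Fin.toℕ-fromℕ< _)
        (λ w≡u → e (trans (cong toℕ (≡-sym w≡u)) (Fin.toℕ-fromℕ< (place<n (toℕ k) k<))))
    ... | no i≢ with ∈-nth (i , k) (∈-small {i , k} i≢)
    ... | e , e< , eq with e <? h
    ... | yes e<h = F.fromℕ< (h≤n e<h) , hub e e<h (Fin.toℕ-fromℕ< _) eq
    -- `vertices small` has `suc h` entries, so a position not below `h` is `h`.
    ... | no e≮h with ≤-antisym (≤-pred (subst (e <_) length-small e<)) (≮⇒≥ e≮h)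
    ... | refl = u , centre eq refl

    leaf-block : ∀ {w} (k : Fin top) → toℕ w ≡ place (block u) (toℕ k) → block w ≡ block u
    leaf-block {w} k e = block-place {w} {block u} (subst (toℕ k <_) top≡ (Fin.toℕ<n k)) e

    leaf-∉ : ∀ {w} (k : Fin top) → toℕ w ≡ place (block u) (toℕ k) → ¬ Hub w
    leaf-∉ {w} k e p = <⇒≱ p (≤-trans (≤-trans (m≤m+n h _) (m≤m+n _ (toℕ k))) (≤-reflexive (≡-sym e)))

    Image-inj : ∀ {x y w} → Image x w → Image y w → x ≡ y
    Image-inj (hub e e< refl p) (hub _ _ refl q) = nth-injective (vertices small) (<-trans e< (≤-reflexive (≡-sym length-small))) p q
    Image-inj (centre p _) (centre q _) = nth-injective (vertices small) (≤-reflexive (≡-sym length-small)) p q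
    Image-inj (leaf k refl e _) (leaf l refl f _) =
      cong (fromℕ m ,_) (Fin.toℕ-injective (+-cancelˡ-≡ (h + block u * suc b) _ _ (trans (≡-sym e) f)))
    Image-inj (newLeaf k refl e _) (newLeaf l refl f _) =
      cong (fromℕ m ,_) (Fin.toℕ-injective (+-cancelˡ-≡ (h + block u * suc b) _ _ (trans (≡-sym e) f)))
    Image-inj (hub e e< refl _) (centre _ refl) = ⊥-elim (u∉ e<)
    Image-inj (hub e e< refl _) (leaf k _ f _) = ⊥-elim (leaf-∉ k f e<)
    Image-inj (hub e e< refl _) (newLeaf _ _ _ refl) = ⊥-elim (v∉ e<)
    Image-inj (centre _ e) (leaf _ _ _ w≢u) = ⊥-elim (w≢u e)
    Image-inj (centre _ e) (newLeaf _ _ _ f) = ⊥-elim (u≢v (trans (≡-sym e) f))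
    Image-inj (leaf k _ e _) (newLeaf _ _ _ refl) = ⊥-elim (<-irrefl (≡-sym (leaf-block k e)) u<v)
    Image-inj (centre _ refl) (hub e e< refl _) = ⊥-elim (u∉ e<)
    Image-inj (leaf k _ f _) (hub e e< refl _) = ⊥-elim (leaf-∉ k f e<)
    Image-inj (newLeaf _ _ _ refl) (hub e e< refl _) = ⊥-elim (v∉ e<)
    Image-inj (leaf _ _ _ w≢u) (centre _ e) = ⊥-elim (w≢u e)
    Image-inj (newLeaf _ _ _ f) (centre _ e) = ⊥-elim (u≢v (trans (≡-sym e) f))
    Image-inj (newLeaf _ _ _ refl) (leaf k _ e _) = ⊥-elim (<-irrefl (≡-sym (leaf-block k e)) u<v)

    old : ∀ {w w′} → Joined w w′ → addEdge (adj graph) u v w w′ ≡ true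
    old {w} {w′} j = addEdge-old (adj graph) u v w w′ (adj⁺ j)

    edge : ∀ {x y w w′} → Image x w → Image y w′ → w ≢ w′ → proj₁ x ≢ proj₁ y → addEdge (adj graph) u v w w′ ≡ true
    edge (hub _ e< refl _) _ w≢ _ = old (w≢ , inj₁ e<)
    edge _ (hub _ e< refl _) w≢ _ = old (w≢ , inj₂ (inj₁ e<))
    edge (centre _ refl) (centre _ refl) w≢ _ = ⊥-elim (w≢ refl)
    edge (centre _ refl) (leaf k _ e _) w≢ _ = old (w≢ , inj₂ (inj₂ (≡-sym (leaf-block k e))))
    edge (centre _ refl) (newLeaf _ _ _ refl) _ _ = addEdge-new (adj graph) u v
    edge (leaf k _ e _) (centre _ refl) w≢ _ = old (w≢ , inj₂ (inj₂ (leaf-block k e)))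
    edge (newLeaf _ _ _ refl) (centre _ refl) _ _ = addEdge-new′ (adj graph) u v
    edge (leaf _ refl _ _) (leaf _ refl _ _) _ x≁y = ⊥-elim (x≁y refl)
    edge (leaf _ refl _ _) (newLeaf _ refl _ _) _ x≁y = ⊥-elim (x≁y refl)
    edge (newLeaf _ refl _ _) (leaf _ refl _ _) _ x≁y = ⊥-elim (x≁y refl)
    edge (newLeaf _ refl _ _) (newLeaf _ refl _ _) _ x≁y = ⊥-elim (x≁y refl)

    φ : V → Fin n
    φ z = proj₁ (image z)

    φ-inj : Injective _≡_ _≡_ φ
    φ-inj {x} {y} e = Image-inj (proj₂ (image x)) (subst (Image y) (≡-sym e) (proj₂ (image y)))

    contains : Contains V (KEdge s) (addEdge (adj graph) u v)
    contains = φ , φ-inj , λ x y x≁y →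
      edge (proj₂ (image x)) (proj₂ (image y)) (λ e → x≁y (cong proj₁ (φ-inj e))) x≁y

  saturated : Saturated V (KEdge s) graph
  saturated = free , extend
    where
    extend : ∀ u v → u ≢ v → adj graph u v ≡ false → Contains V (KEdge s) (addEdge (adj graph) u v)
    extend u v u≢v a with <-cmp (block u) (block v)
    ... | tri≈ _ e _ = ⊥-elim (adj-false {u} {v} a (u≢v , inj₂ (inj₂ e)))
    ... | tri< lt _ _ = Extension.contains u v (λ p → adj-false {u} {v} a (u≢v , inj₁ p))
                                               (λ p → adj-false {u} {v} a (u≢v , inj₂ (inj₁ p))) lt
    ... | tri> _ _ gt with Extension.contains v u (λ p → adj-false {u} {v} a (u≢v , inj₂ (inj₁ p)))
                                                  (λ p → adj-false {u} {v} a (u≢v , inj₁ p)) gt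
    ... | φ , φ-inj , edges = φ , φ-inj , λ x y x≁y → addEdge-flip (adj graph) v u (φ x) (φ y) (edges x y x≁y)

-- Choice of the constants and conclusion.

module Constants (m : ℕ) (1≤m : 1 ≤ m) (s : Fin (suc m) → ℕ) (1≤s : ∀ i → 1 ≤ s i)
                 (mono : ∀ i j → i F.≤ j → s i ≤ s j) where

  open Parts s using (p; top; order)

  c h b D N : ℕ
  c = twiceCoeff m s
  h = p ∸ 1
  b = top ∸ 1
  -- The least degree at which one unit from each neighbour makes up `M * c`.
  D = suc c * c
  N = suc (suc D ^ 4) + (suc c + (2 + order))

  s≤top : ∀ i → s i ≤ top
  s≤top i = mono i (fromℕ m) (Fin.≤fromℕ i)

  p≡ : p ≡ suc h
  p≡ = ≡-sym (m+[n∸m]≡n (positive m 1≤m s 1≤s))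
    where
    positive : ∀ m → 1 ≤ m → (s : Fin (suc m) → ℕ) → (∀ i → 1 ≤ s i) → 1 ≤ sum (map (λ i → s (inject₁ i)) (allFin m))
    positive (suc m) _ s 1≤s = ≤-trans (1≤s F.zero) (m≤m+n _ _)

  top≡ : top ≡ suc b
  top≡ = ≡-sym (m+[n∸m]≡n (1≤s (fromℕ m)))

  -- As `p` and `top` are positive, the truncated subtraction in `twiceCoeff` is exact. The value is
  -- the coefficient in `edges-≤`.
  c≡ : c ≡ 2 * h + b
  c≡ = trans (cong₂ (λ x y → 2 * x + y ∸ 3) p≡ top≡) (trans (cong (_∸ 3) (e h b)) (m+n∸n≡m (2 * h + b) 3))
    where
    e : ∀ h b → 2 * suc h + suc b ≡ 2 * h + b + 3
    e = solve-∀

  c+3 : c + 3 ≡ 2 * p + top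
  c+3 = trans (cong (_+ 3) c≡) (trans (e h b) (≡-sym (cong₂ (λ x y → 2 * x + y) p≡ top≡)))
    where
    e : ∀ h b → 2 * h + b + 3 ≡ 2 * suc h + suc b
    e = solve-∀

  C : ℕ
  C = c * ramseyBound (4 + suc c) N

  upper-bound : ∀ n → Σ (Graph n) λ G → Saturated (KVert s) (KEdge s) G × 2 * edgeCount G ≤ c * n + C
  upper-bound n = HubsAndBlocks.graph h b n , UpperBound.saturated s s≤top h b p≡ top≡ n ,
    ≤-trans (HubsAndBlocks.edges-≤ h b n) (≤-trans (≤-reflexive (cong (_* n) (≡-sym c≡))) (m≤m+n (c * n) C))

  lower-bound : ∀ n (G : Graph n) → Saturated (KVert s) (KEdge s) G → c * n ≤ 2 * edgeCount G + C
  lower-bound n G saturated = Discharge.lower s s≤top c c+3 G saturated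
    (λ u → length (neighbours G u) <ᵇ D) D (λ u l → <⇒≤ (<ᵇ-true l)) (λ u l → <ᵇ-false l) N
    (m≤m+n _ _)
    (≤-trans (m≤m+n (suc c) _) (m≤n+m _ (suc (suc D ^ 4))))
    (≤-trans (≤-trans (m≤m+n 2 order) (m≤n+m _ (suc c))) (m≤n+m _ (suc (suc D ^ 4))))
    (≤-trans (≤-trans (m≤n+m order 2) (m≤n+m _ (suc c))) (m≤n+m _ (suc (suc D ^ 4))))

theorem1p1 : (m : ℕ) → 1 ≤ m → (s : Fin (suc m) → ℕ) →
    (∀ i → 1 ≤ s i) → (∀ i j → i F.≤ j → s i ≤ s j) →
    Σ ℕ λ C → Σ ℕ λ n₀ → (n : ℕ) → n₀ ≤ n →
    (Σ (Graph n) λ G → Saturated (KVert s) (KEdge s) G ×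
    2 * edgeCount G ≤ twiceCoeff m s * n + C)
    × ((G : Graph n) → Saturated (KVert s) (KEdge s) G →
    twiceCoeff m s * n ≤ 2 * edgeCount G + C)
theorem1p1 m 1≤m s 1≤s mono = C , 0 , λ n _ → upper-bound n , lower-bound n
  where open Constants m 1≤m s 1≤s mono
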